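{- If $\alpha$ is an uncountable regular cardinal in $L$ (i.e., $L\models$ "$\alpha$ is an uncountable regular cardinal"), then there are no constructible $\alpha$-wITRM-recognizable subsets of $\alpha$.
   Context: Machines. An $\alpha$-register machine program is an ordinary register machine program: a finite list of numbered lines using finitely many registers, each register containing an ordinal $<\alpha$. Commands: increment a register by $1$; copy one register to another; jump to a given line if two register contents agree (otherwise go to the next line); oracle command: for an oracle $x\subseteq\alpha$, replace the content $\iota$ of register $j$ by $1$ if $\iota\in x$ and by $0$ otherwise. Computations run along the ordinals: at successor times the active command is carried out; at limit times the index of the active program line and each register content are the inferior limits of the sequences of their earlier values. If such an inferior limit of register contents equals $\alpha$ (overflow), the computation of an $\alpha$-wITRM is undefined. Inputs and parameters are written in the first registers, all other registers start with $0$. $P^{x}(\vec\xi)\downarrow=c$ means that $P$ with oracle $x$ and input $\vec\xi$ halts with $c$ in the output register. A set $x\subseteq\alpha$ is $\alpha$-wITRM-recognizable if there are an $\alpha$-wITRM-program $P$ and a parameter $\xi<\alpha$ such that, for all $y\subseteq\alpha$, $P^{y}(\xi)$ is defined and halts with output $1$ if $y=x$ and with output $0$ if $y\neq x$. -}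

module Defs where

open import Level using (Level; _⊔_)
open import Data.Nat.Base using (ℕ; zero; suc)
open import Data.Fin.Base using (Fin; zero; suc)
open import Data.Vec.Base using (Vec; _∷_; lookup)
open import Data.Vec.Functional using (Vector; updateAt)
open import Data.List.Base using (List; head; drop)
open import Data.Maybe.Base using (Maybe; just; nothing; maybe)
open import Data.Product using (Σ; ∃-syntax; Σ-syntax; _×_; _,_; proj₁)
open import Data.Sum.Base using (_⊎_)
open import Data.Empty using (⊥; ⊥-elim)
open import Function.Base using (_∘_; const)
open import Function.Bundles using (_⇔_)
open import Relation.Nullary.Negation using (¬_)
open import Relation.Binary.PropositionalEquality using (_≡_)

-- Notions of the language of set theory, interpreted in a structure
-- (D , ≈ , ∈): all quantifiers range over D, so that instantiating D
-- with an inner model gives the relativised notions.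

module SetTheory {a r : Level} (D : Set a) (_≈_ _∈_ : D → D → Set r) where

  _⊆_ : D → D → Set (a ⊔ r)
  x ⊆ y = ∀ z → z ∈ x → z ∈ y

  IsTransitive : D → Set (a ⊔ r)
  IsTransitive x = ∀ y → y ∈ x → y ⊆ x

  -- In the presence of foundation this is the von Neumann notion.
  IsOrdinal : D → Set (a ⊔ r)
  IsOrdinal x = IsTransitive x × (∀ y → y ∈ x → IsTransitive y)

  IsLimit : D → Set (a ⊔ r)
  IsLimit x = IsOrdinal x × (∃[ y ] y ∈ x) ×
              (∀ y → y ∈ x → ∃[ z ] z ∈ x × y ∈ z)

  IsOmega : D → Set (a ⊔ r)
  IsOmega w = IsLimit w × (∀ v → v ∈ w → ¬ IsLimit v)

  IsUnorderedPair : D → D → D → Set (a ⊔ r)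
  IsUnorderedPair p x y = ∀ z → z ∈ p ⇔ (z ≈ x ⊎ z ≈ y)

  -- Kuratowski pairs
  IsPair : D → D → D → Set (a ⊔ r)
  IsPair p x y = ∃[ u ] ∃[ v ]
    IsUnorderedPair u x x × IsUnorderedPair v x y × IsUnorderedPair p u v

  Maps : D → D → D → Set (a ⊔ r)
  Maps f x y = ∃[ p ] p ∈ f × IsPair p x y

  IsFunction : D → D → D → Set (a ⊔ r)
  IsFunction f b c =
    (∀ p → p ∈ f → ∃[ x ] ∃[ y ] x ∈ b × y ∈ c × IsPair p x y) ×
    (∀ x → x ∈ b → ∃[ y ] y ∈ c × Maps f x y) ×
    (∀ x y y′ → Maps f x y → Maps f x y′ → y ≈ y′)

  IsInjection : D → D → D → Set (a ⊔ r)
  IsInjection f b c =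
    IsFunction f b c × (∀ x x′ y → Maps f x y → Maps f x′ y → x ≈ x′)

  IsBijection : D → D → D → Set (a ⊔ r)
  IsBijection f b c =
    IsInjection f b c × (∀ y → y ∈ c → ∃[ x ] x ∈ b × Maps f x y)

  IsCardinal : D → Set (a ⊔ r)
  IsCardinal κ = IsOrdinal κ × (∀ β → β ∈ κ → ¬ (∃[ f ] IsBijection f β κ))

  -- The range of f : β → κ is cofinal in κ.
  IsCofinal : D → D → D → Set (a ⊔ r)
  IsCofinal f β κ =
    ∀ γ → γ ∈ κ → ∃[ δ ] ∃[ η ] δ ∈ β × η ∈ κ × Maps f δ η × γ ⊆ η

  IsRegular : D → Set (a ⊔ r)
  IsRegular κ =
    IsLimit κ ×
    (∀ β → β ∈ κ → ¬ (∃[ f ] IsFunction f β κ × IsCofinal f β κ))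

  IsUncountable : D → Set (a ⊔ r)
  IsUncountable x = ∀ w → IsOmega w → ¬ (∃[ f ] IsInjection f x w)

  IsUncountableRegularCardinal : D → Set (a ⊔ r)
  IsUncountableRegularCardinal κ =
    IsCardinal κ × IsRegular κ × IsUncountable κ

-- The universe of sets: Aczel's iterative sets with extensional equality.
-- Given excluded middle it satisfies ZFC.

data V : Set₁ where
  sup : (I : Set) → (I → V) → V

index : V → Set
index (sup I _) = I

element : (x : V) → index x → V
element (sup _ f) = f

infix 4 _≈_ _∈_

_≈_ : V → V → Set
sup I f ≈ sup J g = (∀ i → ∃[ j ] f i ≈ g j) × (∀ j → ∃[ i ] f i ≈ g j)

_∈_ : V → V → Set
x ∈ y = ∃[ j ] x ≈ element y j

open SetTheory V _≈_ _∈_ public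

∅ : V
∅ = sup ⊥ ⊥-elim

infix 8 _⁺

-- x ∪ {x}
_⁺ : V → V
x ⁺ = sup (Maybe (index x)) (maybe (element x) x)

numeral : ℕ → V
numeral zero    = ∅
numeral (suc n) = numeral n ⁺

-- First-order formulas with de Bruijn variables; the remaining
-- connectives are classically definable.

data Formula (n : ℕ) : Set where
  _∈ᶠ_ _≈ᶠ_ : Fin n → Fin n → Formula n
  ¬ᶠ_       : Formula n → Formula n
  _∧ᶠ_      : Formula n → Formula n → Formula n
  ∃ᶠ_       : Formula (suc n) → Formula n

-- Satisfaction in the structure (x , ∈), elements of x being given by
-- their indices.
Sat : (x : V) {n : ℕ} → Formula n → Vec (index x) n → Set
Sat x (i ∈ᶠ j)  ρ = element x (lookup ρ i) ∈ element x (lookup ρ j)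
Sat x (i ≈ᶠ j)  ρ = element x (lookup ρ i) ≈ element x (lookup ρ j)
Sat x (¬ᶠ φ)    ρ = ¬ Sat x φ ρ
Sat x (φ ∧ᶠ ψ)  ρ = Sat x φ ρ × Sat x ψ ρ
Sat x (∃ᶠ φ)    ρ = ∃[ i ] Sat x φ (i ∷ ρ)

-- The set of all { a ∈ x ∣ x ⊨ φ(a , ρ) } with parameters ρ from x.
Def : V → V
Def x = sup (Σ[ n ∈ ℕ ] Formula (suc n) × Vec (index x) n)
  λ (n , φ , ρ) → sup (∃[ i ] Sat x φ (i ∷ ρ)) (element x ∘ proj₁)

⋃ᵢ : {I : Set} → (I → V) → V
⋃ᵢ {I} g = sup (Σ[ i ∈ I ] index (g i)) λ (i , j) → element (g i) j

-- L α = ⋃_{β ∈ α} Def (L β), which for ordinals α agrees with the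
-- definition by zero, successor and limit cases.
L : V → V
L (sup I f) = ⋃ᵢ λ i → Def (L (f i))

IsConstructible : V → Set₁
IsConstructible x = ∃[ β ] IsOrdinal β × x ∈ L β

𝕃 : Set₁
𝕃 = Σ V IsConstructible

module InL = SetTheory 𝕃 (λ x y → proj₁ x ≈ proj₁ y) (λ x y → proj₁ x ∈ proj₁ y)

data Instruction (k : ℕ) : Set where
  increment : Fin k → Instruction k
  copy      : (from to : Fin k) → Instruction k
  jumpIf≈   : (i j : Fin k) (target : ℕ) → Instruction k
  oracle    : Fin k → Instruction k

-- There is at least one register: register zero serves both for the
-- parameter and for the output. Lines are numbered from 0.
record Program : Set where
  field
    extraRegisters : ℕ
    code           : List (Instruction (suc extraRegisters))

  registers : ℕ
  registers = suc extraRegisters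

  instructionAt : ℕ → Maybe (Instruction registers)
  instructionAt l = head (drop l code)

record Configuration (k : ℕ) : Set₁ where
  constructor config
  field
    line : ℕ
    regs : Vector V k

open Configuration public

infix 4 _≋_

_≋_ : {k : ℕ} → Vector V k → Vector V k → Set
r ≋ s = ∀ i → r i ≈ s i

-- Execute ι x c d: with oracle x, carrying out ι in c results in d.
Execute : {k : ℕ} → Instruction k → V → Configuration k → Configuration k → Set
Execute (increment j) x c d =
  line d ≡ suc (line c) × regs d ≋ updateAt (regs c) j _⁺
Execute (copy i j) x c d =
  line d ≡ suc (line c) × regs d ≋ updateAt (regs c) j (const (regs c i))
Execute (jumpIf≈ i j l) x c d =
  regs d ≋ regs c ×
  (regs c i ≈ regs c j → line d ≡ l) ×
  (¬ (regs c i ≈ regs c j) → line d ≡ suc (line c))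
Execute (oracle j) x c d =
  line d ≡ suc (line c) ×
  (regs c j ∈ x → regs d ≋ updateAt (regs c) j (const (numeral 1))) ×
  (¬ (regs c j ∈ x) → regs d ≋ updateAt (regs c) j (const (numeral 0)))

-- v = sup_{s < t} inf_{s ≤ r < t} f r for an ordinal-valued f and a limit
-- ordinal t; on von Neumann ordinals sup, inf and ≤ are ⋃, ⋂ and ⊆.
IsLimInf : (t : V) (f : V → V) (v : V) → Set₁
IsLimInf t f v =
  ∀ z → z ∈ v ⇔ (∃[ s ] s ∈ t × (∀ r → r ∈ t → s ⊆ r → z ∈ f r))

initialRegs : {k : ℕ} → V → Vector V (suc k)
initialRegs ξ zero    = ξ
initialRegs ξ (suc _) = ∅

-- A halting α-wITRM computation of P with oracle x on parameter ξ. Only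
-- the values of `configuration` at times ≤ `haltingTime` matter. The
-- field `bounded` expresses that no overflow occurs, i.e. that the
-- computation is defined. The machine halts when the active line is not
-- a line of the program.
record HaltingComputation (α : V) (P : Program) (x ξ : V) : Set₁ where
  open Program P
  field
    haltingTime   : V
    ordinal       : IsOrdinal haltingTime
    configuration : V → Configuration registers
    line-cong     : ∀ s t → s ≈ t → line (configuration s) ≡ line (configuration t)
    regs-cong     : ∀ s t → s ≈ t → regs (configuration s) ≋ regs (configuration t)
    start-line    : line (configuration ∅) ≡ 0
    start-regs    : regs (configuration ∅) ≋ initialRegs ξ
    step          : ∀ t → t ∈ haltingTime →
                    ∃[ ι ] instructionAt (line (configuration t)) ≡ just ι ×
                           Execute ι x (configuration t) (configuration (t ⁺))
    limit-line    : ∀ t → t ∈ haltingTime ⁺ → IsLimit t →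
                    IsLimInf t (λ s → numeral (line (configuration s)))
                               (numeral (line (configuration t)))
    limit-regs    : ∀ t → t ∈ haltingTime ⁺ → IsLimit t → ∀ j →
                    IsLimInf t (λ s → regs (configuration s) j)
                               (regs (configuration t) j)
    bounded       : ∀ t → t ∈ haltingTime ⁺ → ∀ j → regs (configuration t) j ∈ α
    halt          : instructionAt (line (configuration haltingTime)) ≡ nothing

  output : V
  output = regs (configuration haltingTime) zero

-- P^x(ξ)↓ = c
HaltsWith : (α : V) (P : Program) (x ξ c : V) → Set₁
HaltsWith α P x ξ c =
  Σ[ C ∈ HaltingComputation α P x ξ ] HaltingComputation.output C ≈ c

IsRecognizable : (α x : V) → Set₁
IsRecognizable α x =
  ∃[ P ] ∃[ ξ ] ξ ∈ α ×
  (∀ y → y ⊆ α →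
    (y ≈ x → HaltsWith α P y ξ (numeral 1)) ×
    (¬ (y ≈ x) → HaltsWith α P y ξ (numeral 0)))

{-# OPTIONS --safe #-}

-- Suppose that P with parameter ξ recognizes a constructible x ⊆ α, and let
-- θ be the length of its run with oracle x. The run below an ordinal of L
-- is in L, by recursion inside L, so that regularity of α in L applies to
-- it.
--
-- If θ ≥ α, let ρ be the configuration at time α. From some time on, all
-- components are at least ρ, and each of them is ρ cofinally often; since α
-- has uncountable cofinality in L, some limit time T < α is a limit of times
-- at which each component was ρ. The configuration at T is then ρ again, so
-- from T on the run loops with period α - T forever, and never halts.
--
-- Hence θ < α, and the register contents of the run are bounded by some
-- g < α. Toggling whether g is in the oracle does not affect the run, so x
-- is not the only oracle that P accepts.
--
-- For recursion in L, call a predicate definable if it is first-order over L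
-- with constructible constants. By reflection, a definable class bounded by
-- a set is a set of L.

module Submission where

open import Defs
open import Level using (Level; Lift; lift; lower; 0ℓ; _⊔_) renaming (suc to lsuc)
open import Axiom.ExcludedMiddle using (ExcludedMiddle)
open import Data.Bool.Base using (Bool; true; false; if_then_else_)
open import Data.Empty using (⊥; ⊥-elim)
open import Data.Fin.Base using (Fin; zero; suc; toℕ; _↑ˡ_; _↑ʳ_; splitAt)
open import Data.Fin.Properties using (splitAt-↑ˡ; splitAt-↑ʳ; toℕ-injective) renaming (_≟_ to _≟ᶠ_)
open import Data.List.Base using (List; []; _∷_; head; drop) renaming (lookup to lookupˡ)
open import Data.Maybe.Base using (Maybe; just; nothing)
open import Data.Nat.Base using (ℕ; zero; suc; _+_; _≤_)
import Data.Nat.Base as ℕ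
import Data.Nat.Properties as ℕ
open import Data.Product using (Σ; Σ-syntax; ∃-syntax; _×_; _,_; proj₁; proj₂)
open import Data.Sum.Base using (_⊎_; inj₁; inj₂; [_,_]′)
open import Data.Unit.Polymorphic.Base using (⊤; tt)
open import Data.Vec.Base using (Vec; []; _∷_; lookup; tabulate)
open import Data.Vec.Functional using (updateAt)
open import Data.Vec.Functional.Properties using (updateAt-updates; updateAt-minimal)
open import Data.Vec.Properties using (lookup∘tabulate)
open import Function.Base using (_∘_; id; const; case_of_)
open import Function.Bundles using (_⇔_; mk⇔; module Equivalence)
open import Relation.Nullary using (¬_; Dec; yes; no)
import Relation.Nullary.Decidable as Dec
open import Relation.Binary.PropositionalEquality using (_≡_; _≢_; refl; sym; trans; cong; subst)

-- The obstacle is that `α` is regular only as seen from L. In the surrounding universe it may be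
-- singular or countable, while the run is given there and not in L. So each bound obtained from
-- regularity goes through `collection`, which accepts definable predicates only, and recursion
-- inside L is needed twice: for the run itself (`Trace`) and for the ω-sequence of recurrence times
-- whose supremum is `T` (`Repetition`). One repeated configuration does not by itself force a loop:
-- at a limit of infinitely many periods the limits inferior could produce something new. What
-- excludes this is that `ρ` is a componentwise minimum of the period. No component drops below `ρ`
-- during a period and every period ends in `ρ`, so a limit of periods is `ρ` once more.
-- Comprehension in L is used only for classes covered by a family indexed by a type in `Set`;
-- reflection then supplies a single stage over which the class is first-order definable.

private
  variable
    ℓ ℓ′ : Level
    x y z w a b c : V
    n k m : ℕ


infix 1 _⟺_
record _⟺_ (A : Set ℓ) (B : Set ℓ′) : Set (ℓ ⊔ ℓ′) where
  constructor mk⟺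
  field
    to   : A → B
    from : B → A

open _⟺_ public

-- Sets

≈-refl : x ≈ x
≈-refl {sup I f} = (λ i → i , ≈-refl) , (λ i → i , ≈-refl)

≈-sym : x ≈ y → y ≈ x
≈-sym {sup I f} {sup J g} (p , q) =
  (λ j → proj₁ (q j) , ≈-sym (proj₂ (q j))) ,
  (λ i → proj₁ (p i) , ≈-sym (proj₂ (p i)))

≈-trans : x ≈ y → y ≈ z → x ≈ z
≈-trans {sup I f} {sup J g} {sup K h} (p , q) (p′ , q′) =
  (λ i → let j , e = p i; k , e′ = p′ j in k , ≈-trans e e′) ,
  (λ k → let j , e = q′ k; i , e′ = q j in i , ≈-trans e′ e)

-- A copy of _∈_ that does not reduce, so that its arguments can be
-- inferred.
infix 4 _ε_ _⊑_
record _ε_ (x y : V) : Set where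
  constructor mk
  field un : x ∈ y

open _ε_ public

elem : ∀ y (j : index y) → element y j ε y
elem y j = mk (j , ≈-refl)

εˡ : x ≈ y → x ε z → y ε z
εˡ e (mk (j , p)) = mk (j , ≈-trans (≈-sym e) p)

εʳ : y ≈ z → x ε y → x ε z
εʳ {sup I f} {sup J g} (p , _) (mk (i , e)) =
  mk (proj₁ (p i) , ≈-trans e (proj₂ (p i)))

-- Quantifying over the indices of `x` keeps this in `Set`, whereas `_⊆_` on `V` is in `Set₁`. The
-- small version can occur in predicates given to `sep` and can restrict an index type, as in
-- `shift`.
record _⊑_ (x y : V) : Set where
  constructor sub
  field incl : ∀ i → element x i ε y

open _⊑_ public

infixr 5 _▹_
_▹_ : z ε x → x ⊑ y → z ε y
mk (i , e) ▹ s = εˡ (≈-sym e) (incl s i)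

⊑-intro : (∀ z → z ε x → z ε y) → x ⊑ y
⊑-intro {x} h = sub λ i → h _ (elem x i)

⊑-refl : x ⊑ x
⊑-refl = ⊑-intro λ _ → id

⊑-trans : x ⊑ y → y ⊑ z → x ⊑ z
⊑-trans p q = ⊑-intro λ _ m → (m ▹ p) ▹ q

≈⇒⊑ : x ≈ y → x ⊑ y
≈⇒⊑ e = ⊑-intro λ _ → εʳ e

⊑-antisym : x ⊑ y → y ⊑ x → x ≈ y
⊑-antisym {sup I f} {sup J g} (sub p) (sub q) =
  (λ i → un (p i)) ,
  (λ j → let i , e = un (q j) in i , ≈-sym e)

ext : (∀ z → z ε x → z ε y) → (∀ z → z ε y → z ε x) → x ≈ y
ext p q = ⊑-antisym (⊑-intro p) (⊑-intro q)

⊆⇒⊑ : x ⊆ y → x ⊑ y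
⊆⇒⊑ h = ⊑-intro λ z m → mk (h z (un m))

⊑⇒⊆ : x ⊑ y → x ⊆ y
⊑⇒⊆ s z m = un (mk m ▹ s)

-- No congruence is assumed of `P`, so the structural recursion treats all sets equal to `x` at
-- once.
ε-induction : (P : V → Set ℓ) → (∀ x → (∀ y → y ε x → P y) → P x) → ∀ x → P x
ε-induction P step x = go x x ≈-refl
  where
  go : ∀ x y → y ≈ x → P y
  go (sup I f) y e = step y λ z m →
    let i , e′ = un (εʳ e m) in go (f i) z e′

ε-irrefl : ∀ x → ¬ x ε x
ε-irrefl = ε-induction _ λ x ih m → ih x m m

ε-asym : x ε y → ¬ y ε x
ε-asym {x} {y} = ε-induction (λ x → ∀ y → x ε y → ¬ y ε x) (λ x ih y m n → ih y n x n m) x y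

∅-empty : ¬ x ε ∅
∅-empty (mk ())

⁺-elim : z ε x ⁺ → z ε x ⊎ z ≈ x
⁺-elim {x = sup I f} (mk (just i , e))  = inj₁ (mk (i , e))
⁺-elim {x = sup I f} (mk (nothing , e)) = inj₂ e

⁺-old : z ε x → z ε x ⁺
⁺-old {x = sup I f} (mk (i , e)) = mk (just i , e)

⁺-new : x ε x ⁺
⁺-new {sup I f} = mk (nothing , ≈-refl)

x⊑x⁺ : x ⊑ x ⁺
x⊑x⁺ = ⊑-intro λ _ → ⁺-old

⁺-mono : x ⊑ y → x ε y ⊎ x ≈ y → x ⁺ ⊑ y ⁺
⁺-mono s h = ⊑-intro λ z m → [ (λ n → ⁺-old (n ▹ s)) , (λ e → εˡ (≈-sym e) (new h)) ]′ (⁺-elim m)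
  where
  new : x ε y ⊎ x ≈ y → x ε y ⁺
  new (inj₁ m) = ⁺-old m
  new (inj₂ e) = εˡ (≈-sym e) ⁺-new

⁺-cong : x ≈ y → x ⁺ ≈ y ⁺
⁺-cong e = ⊑-antisym (⁺-mono (≈⇒⊑ e) (inj₂ e)) (⁺-mono (≈⇒⊑ (≈-sym e)) (inj₂ (≈-sym e)))

⁺-least : x ⊑ y → x ε y → x ⁺ ⊑ y
⁺-least s m = ⊑-intro λ z n → [ _▹ s , (λ e → εˡ (≈-sym e) m) ]′ (⁺-elim n)

⋃-intro : {I : Set} (g : I → V) (i : I) → z ε g i → z ε ⋃ᵢ g
⋃-intro _ i (mk (j , e)) = mk ((i , j) , e)

⋃-elim : {I : Set} (g : I → V) → z ε ⋃ᵢ g → ∃[ i ] z ε g i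
⋃-elim _ (mk ((i , j) , e)) = i , mk (j , e)

infixl 6 _∪_
_∪_ : V → V → V
x ∪ y = ⋃ᵢ (if_then x else y)

⊑-∪ˡ : x ⊑ x ∪ y
⊑-∪ˡ {x} {y} = ⊑-intro λ _ → ⋃-intro (if_then x else y) true

⊑-∪ʳ : y ⊑ x ∪ y
⊑-∪ʳ {y} {x} = ⊑-intro λ _ → ⋃-intro (if_then x else y) false

∪-elim : z ε x ∪ y → z ε x ⊎ z ε y
∪-elim {x = x} {y} m with ⋃-elim (if_then x else y) m
... | true , n = inj₁ n
... | false , n = inj₂ n

-- Separation and ordered pairs

abstract
  -- Small predicates only: one that quantifies over `V` lies in `Set₁` and cannot restrict an index
  -- type in `Set`. This is why `Hit₀` below quantifies over indices.
  sep : (a : V) → (V → Set) → V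
  sep a P = sup (Σ[ i ∈ index a ] P (element a i)) (element a ∘ proj₁)

  sep-elim : {P : V → Set} → z ε sep a P → z ε a × ∃[ y ] z ≈ y × P y
  sep-elim {a = a} (mk ((i , p) , e)) = mk (i , e) , element a i , e , p

  sep-intro : {P : V → Set} → (∀ {y} → z ≈ y → P z → P y) → z ε a → P z → z ε sep a P
  sep-intro resp (mk (i , e)) p = mk ((i , resp e p) , e)

abstract
  upair : V → V → V
  upair x y = sup Bool λ b → if b then x else y

  upair-elim : z ε upair x y → z ≈ x ⊎ z ≈ y
  upair-elim (mk (true , e))  = inj₁ e
  upair-elim (mk (false , e)) = inj₂ e

  upair-fst : x ε upair x y
  upair-fst = mk (true , ≈-refl)

  upair-snd : y ε upair x y
  upair-snd = mk (false , ≈-refl)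

  pair : V → V → V
  pair x y = upair (upair x x) (upair x y)

  pair-unfold : pair x y ≈ upair (upair x x) (upair x y)
  pair-unfold = ≈-refl

upair-cong : x ≈ y → z ≈ w → upair x z ≈ upair y w
upair-cong p q = ⊑-antisym (half p q) (half (≈-sym p) (≈-sym q))
  where
  half : x ≈ y → z ≈ w → upair x z ⊑ upair y w
  half p q = ⊑-intro λ u m → [ (λ e → εˡ (≈-sym (≈-trans e p)) upair-fst) ,
                               (λ e → εˡ (≈-sym (≈-trans e q)) upair-snd) ]′ (upair-elim m)

pair-cong : x ≈ y → z ≈ w → pair x z ≈ pair y w
pair-cong p q = ≈-trans pair-unfold (≈-trans (upair-cong (upair-cong p p) (upair-cong p q)) (≈-sym pair-unfold))

pair-unfold₂ : pair x y ≈ pair z w → upair (upair x x) (upair x y) ≈ upair (upair z z) (upair z w)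
pair-unfold₂ e = ≈-trans (≈-sym pair-unfold) (≈-trans e pair-unfold)

private
  single : upair x x ≈ upair y z → x ≈ y × x ≈ z
  single e = (λ m → [ ≈-sym , ≈-sym ]′ (upair-elim m)) (εʳ (≈-sym e) upair-fst) ,
             (λ m → [ ≈-sym , ≈-sym ]′ (upair-elim m)) (εʳ (≈-sym e) upair-snd)

pair-injˡ : pair x y ≈ pair z w → x ≈ z
pair-injˡ e with upair-elim (εʳ (pair-unfold₂ e) upair-fst)
... | inj₁ p = proj₁ (single p)
... | inj₂ p = proj₁ (single p)

upair-injʳ : upair x y ≈ upair x z → y ≈ z
upair-injʳ e with upair-elim (εʳ e upair-snd) | upair-elim (εʳ (≈-sym e) upair-snd)
... | inj₂ p | _      = p
... | inj₁ p | inj₁ q = ≈-trans p (≈-sym q)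
... | inj₁ p | inj₂ q = ≈-sym q

pair-injʳ : pair x y ≈ pair z w → y ≈ w
pair-injʳ e = upair-injʳ (upair-injʳ (pair-unfold₂ (≈-trans (pair-cong (≈-sym (pair-injˡ e)) ≈-refl) e)))

-- The constructible hierarchy

Sat-cong : x ≈ y → ∀ {n} (φ : Formula n) {ρ σ} →
           (∀ i → element x (lookup ρ i) ≈ element y (lookup σ i)) →
           Sat x φ ρ → Sat y φ σ
Sat-cong e (i ∈ᶠ j) h p = un (εʳ (h j) (εˡ (h i) (mk p)))
Sat-cong e (i ≈ᶠ j) h p = ≈-trans (≈-sym (h i)) (≈-trans p (h j))
Sat-cong e (¬ᶠ φ)   h p q = p (Sat-cong (≈-sym e) φ (≈-sym ∘ h) q)
Sat-cong e (φ ∧ᶠ ψ) h (p , q) = Sat-cong e φ h p , Sat-cong e ψ h q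
Sat-cong {x} e (∃ᶠ φ) h (i , p) =
  let j , e′ = un (εʳ e (elem x i))
  in j , Sat-cong e φ (λ { zero → e′ ; (suc k) → h k }) p

transport-params : x ≈ y → ∀ {n} (ρ : Vec (index x) n) →
                   Σ[ σ ∈ Vec (index y) n ] ∀ i → element x (lookup ρ i) ≈ element y (lookup σ i)
transport-params e [] = [] , λ ()
transport-params {x} e (i ∷ ρ) =
  let j , e′ = un (εʳ e (elem x i))
      σ , h  = transport-params e ρ
  in j ∷ σ , λ { zero → e′ ; (suc k) → h k }

definable : (x : V) {n : ℕ} → Formula (suc n) → Vec (index x) n → V
definable x φ ρ = element (Def x) (_ , φ , ρ)

definable-intro : ∀ {n} (φ : Formula (suc n)) {ρ} i → z ≈ element x i → Sat x φ (i ∷ ρ) → z ε definable x φ ρ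
definable-intro φ i e s = mk ((i , s) , e)

definable-elim : ∀ {n} (φ : Formula (suc n)) {ρ} → z ε definable x φ ρ →
                 ∃[ i ] z ≈ element x i × Sat x φ (i ∷ ρ)
definable-elim φ (mk ((i , s) , e)) = i , e , s

definable-ε : ∀ {n} (φ : Formula (suc n)) ρ → definable x φ ρ ε Def x
definable-ε {x} φ ρ = elem (Def x) (_ , φ , ρ)

Def-⊑ : y ε Def x → y ⊑ x
Def-⊑ {x = x} (mk ((n , φ , ρ) , e)) = ⊑-intro λ z m →
  let i , e′ , _ = definable-elim φ (εʳ e m) in mk (i , e′)

Def-mono : x ≈ y → Def x ⊑ Def y
Def-mono {x} {y} e = sub λ (n , φ , ρ) →
  let σ , h = transport-params e ρ
      half : ∀ {x y ρ σ} → x ≈ y →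
             (∀ i → element x (lookup ρ i) ≈ element y (lookup σ i)) →
             definable x φ ρ ⊑ definable y φ σ
      half {x} e h = ⊑-intro λ z m →
        let i , e₁ , s = definable-elim φ m
            j , e₂ = un (εʳ e (elem x i))
        in definable-intro φ j (≈-trans e₁ e₂)
             (Sat-cong e φ (λ { zero → e₂ ; (suc k) → h k }) s)
  in εˡ (⊑-antisym (half (≈-sym e) (≈-sym ∘ h)) (half e h)) (definable-ε φ σ)

L-elim : z ε L a → ∃[ b ] b ε a × z ε Def (L b)
L-elim {a = sup I f} m =
  let i , n = ⋃-elim (λ i → Def (L (f i))) m in f i , elem (sup I f) i , n

L-mono : a ⊑ b → L a ⊑ L b
L-cong : a ≈ b → L a ≈ L b
L-cong {sup I f} {sup J g} (p , q) = ⊑-antisym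
  (⊑-intro λ z m → let i , n = ⋃-elim (λ i → Def (L (f i))) m; j , e = p i in
    ⋃-intro (λ j → Def (L (g j))) j (n ▹ Def-mono (L-cong e)))
  (⊑-intro λ z m → let j , n = ⋃-elim (λ j → Def (L (g j))) m; i , e = q j in
    ⋃-intro (λ i → Def (L (f i))) i (n ▹ Def-mono (≈-sym (L-cong e))))
L-mono {sup I f} {sup J g} s = ⊑-intro λ z m →
  let i , n = ⋃-elim (λ i → Def (L (f i))) m
      j , e = un (incl s i)
  in ⋃-intro (λ j → Def (L (g j))) j (n ▹ Def-mono (L-cong e))

L-intro : b ε a → z ε Def (L b) → z ε L a
L-intro {a = sup I f} (mk (i , e)) m = ⋃-intro (λ i → Def (L (f i))) i (m ▹ Def-mono (L-cong e))

module Classical (em : ExcludedMiddle (lsuc 0ℓ)) where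

  em₀ : {P : Set} → Dec P
  em₀ {P} = Dec.map′ lower lift (em {Lift (lsuc 0ℓ) P})

  ¬¬-elim : {P : Set₁} → ¬ ¬ P → P
  ¬¬-elim {P} h with em {P}
  ... | yes p = p
  ... | no ¬p = ⊥-elim (h ¬p)

  least : (P : V → Set₁) → ∃[ x ] P x → ∃[ x ] P x × (∀ y → y ε x → ¬ P y)
  least P (x , p) = ¬¬-elim λ h →
    ε-induction (λ x → ¬ P x) (λ x ih p → h (x , p , ih)) x p

  -- Ordinals

  record Ord (x : V) : Set₁ where
    field
      trans₀ : y ε x → z ε y → z ε x
      trans₁ : y ε x → z ε y → w ε z → w ε y

  open Ord public

  fromOrdinal : IsOrdinal x → Ord x
  fromOrdinal (t , h) = record
    { trans₀ = λ m n → mk (t _ (un m) _ (un n))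
    ; trans₁ = λ m n k → mk (h _ (un m) _ (un n) _ (un k)) }

  toOrdinal : Ord x → IsOrdinal x
  toOrdinal o = (λ y m z n → un (trans₀ o (mk m) (mk n))) ,
                (λ y m z n w k → un (trans₁ o (mk m) (mk n) (mk k)))

  ord-ε : Ord x → y ε x → Ord y
  ord-ε o m = record { trans₀ = trans₁ o m ; trans₁ = λ n → trans₁ o (trans₀ o m n) }

  ord-cong : x ≈ y → Ord x → Ord y
  ord-cong e o = record
    { trans₀ = λ m n → εʳ e (trans₀ o (εʳ (≈-sym e) m) n)
    ; trans₁ = λ m → trans₁ o (εʳ (≈-sym e) m) }

  ord-⊑ : Ord x → y ε x → y ⊑ x
  ord-⊑ o m = ⊑-intro λ _ → trans₀ o m

  ord-∅ : Ord ∅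
  ord-∅ = record { trans₀ = λ m → ⊥-elim (∅-empty m) ; trans₁ = λ m → ⊥-elim (∅-empty m) }

  ord-⁺ : Ord x → Ord (x ⁺)
  ord-⁺ {x} o = record
    { trans₀ = λ m n → ⁺-old ([ (λ k → trans₀ o k n) , (λ e → εʳ e n) ]′ (⁺-elim m))
    ; trans₁ = λ m → [ trans₁ o , (λ e n k → εʳ (≈-sym e) (trans₀ o (εʳ e n) k)) ]′ (⁺-elim m) }

  ord-⋃ : {I : Set} {g : I → V} → (∀ i → Ord (g i)) → Ord (⋃ᵢ g)
  ord-⋃ {g = g} o = record
    { trans₀ = λ m n → let i , k = ⋃-elim g m in ⋃-intro g i (trans₀ (o i) k n)
    ; trans₁ = λ m → let i , k = ⋃-elim g m in trans₁ (o i) k }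

  ord-∪ : Ord x → Ord y → Ord (x ∪ y)
  ord-∪ {x} {y} ox oy = ord-⋃ {g = if_then x else y} λ { true → ox ; false → oy }

  -- Double induction: if neither is an element of the other, the two induction hypotheses put every
  -- element of each into the other.
  trichotomy : Ord x → Ord y → x ε y ⊎ x ≈ y ⊎ y ε x
  trichotomy {x} {y} = ε-induction
    (λ x → ∀ y → Ord x → Ord y → x ε y ⊎ x ≈ y ⊎ y ε x)
    (λ x ihx → ε-induction _ λ y ihy ox oy → go x ihx y ihy ox oy em₀ em₀) x y
    where
    go : ∀ x → (∀ x′ → x′ ε x → ∀ y → Ord x′ → Ord y → x′ ε y ⊎ x′ ≈ y ⊎ y ε x′) →
         ∀ y → (∀ y′ → y′ ε y → Ord x → Ord y′ → x ε y′ ⊎ x ≈ y′ ⊎ y′ ε x) →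
         Ord x → Ord y → Dec (x ε y) → Dec (y ε x) → x ε y ⊎ x ≈ y ⊎ y ε x
    go x ihx y ihy ox oy (yes m) _ = inj₁ m
    go x ihx y ihy ox oy (no _) (yes m) = inj₂ (inj₂ m)
    go x ihx y ihy ox oy (no n) (no n′) = inj₂ (inj₁ (ext l r))
      where
      l : ∀ z → z ε x → z ε y
      l z m with ihx z m y (ord-ε ox m) oy
      ... | inj₁ k = k
      ... | inj₂ (inj₁ e) = ⊥-elim (n′ (εˡ e m))
      ... | inj₂ (inj₂ k) = ⊥-elim (n′ (trans₀ ox m k))
      r : ∀ z → z ε y → z ε x
      r z m with ihy z m ox (ord-ε oy m)
      ... | inj₁ k = ⊥-elim (n (trans₀ oy m k))
      ... | inj₂ (inj₁ e) = ⊥-elim (n (εˡ (≈-sym e) m))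
      ... | inj₂ (inj₂ k) = k

  ord-split : Ord x → Ord y → x ε y ⊎ y ⊑ x
  ord-split ox oy with trichotomy ox oy
  ... | inj₁ m = inj₁ m
  ... | inj₂ (inj₁ e) = inj₂ (≈⇒⊑ (≈-sym e))
  ... | inj₂ (inj₂ m) = inj₂ (ord-⊑ ox m)

  ⊑-split : Ord x → Ord y → x ⊑ y → x ε y ⊎ x ≈ y
  ⊑-split ox oy s with ord-split ox oy
  ... | inj₁ m = inj₁ m
  ... | inj₂ s′ = inj₂ (⊑-antisym s s′)

  ⊑-ε : Ord y → Ord z → x ⊑ y → y ε z → Ord x → x ε z
  ⊑-ε oy oz s m ox with ⊑-split ox oy s
  ... | inj₁ k = trans₀ oz m k
  ... | inj₂ e = εˡ (≈-sym e) m

  ε⇒⋢ : x ε y → ¬ y ⊑ x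
  ε⇒⋢ m s = ε-irrefl _ (m ▹ s)

  ⁺-⊑ : Ord y → x ε y → x ⁺ ⊑ y
  ⁺-⊑ o m = ⁺-least (ord-⊑ o m) m

  -- Limit ordinals and ω

  record Limit (x : V) : Set₁ where
    field
      isOrd  : Ord x
      has-∅  : ∅ ε x
      has-⁺  : y ε x → y ⁺ ε x

  open Limit public

  ∅-least : Ord x → y ε x → ∅ ε x
  ∅-least o m with trichotomy ord-∅ o
  ... | inj₁ k = k
  ... | inj₂ (inj₁ e) = ⊥-elim (∅-empty (εʳ (≈-sym e) m))
  ... | inj₂ (inj₂ k) = ⊥-elim (∅-empty k)

  fromLimit : IsLimit x → Limit x
  fromLimit (o , (y , m) , h) = record
    { isOrd = o′
    ; has-∅ = ∅-least o′ (mk m)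
    ; has-⁺ = λ {y} k → let z , p , q = h y (un k) in
        ⊑-ε (ord-ε o′ (mk p)) o′ (⁺-⊑ (ord-ε o′ (mk p)) (mk q)) (mk p) (ord-⁺ (ord-ε o′ k)) }
    where o′ = fromOrdinal o

  toLimit : Limit x → IsLimit x
  toLimit l = toOrdinal (isOrd l) , (∅ , un (has-∅ l)) ,
    λ y m → y ⁺ , un (has-⁺ l (mk m)) , un (⁺-new {y})

  limit-cong : x ≈ y → Limit x → Limit y
  limit-cong e l = record
    { isOrd = ord-cong e (isOrd l)
    ; has-∅ = εʳ e (has-∅ l)
    ; has-⁺ = λ m → εʳ e (has-⁺ l (εʳ (≈-sym e) m)) }

  ordinal-cases : Ord x → x ≈ ∅ ⊎ (∃[ y ] y ε x × x ≈ y ⁺) ⊎ Limit x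
  ordinal-cases {x} o with em₀ {x ≈ ∅} | em {∃[ y ] y ε x × x ≈ y ⁺}
  ... | yes e | _ = inj₁ e
  ... | no _ | yes s = inj₂ (inj₁ s)
  ... | no n | no n′ = inj₂ (inj₂ record { isOrd = o ; has-∅ = zeroε ; has-⁺ = sucε })
    where
    zeroε : ∅ ε x
    zeroε with trichotomy ord-∅ o
    ... | inj₁ k = k
    ... | inj₂ (inj₁ e) = ⊥-elim (n (≈-sym e))
    ... | inj₂ (inj₂ k) = ⊥-elim (∅-empty k)
    sucε : ∀ {y} → y ε x → y ⁺ ε x
    sucε {y} m with ⊑-split (ord-⁺ (ord-ε o m)) o (⁺-⊑ o m)
    ... | inj₁ k = k
    ... | inj₂ e = ⊥-elim (n′ (y , m , ≈-sym e))

  limit-≉∅ : Limit x → ¬ x ≈ ∅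
  limit-≉∅ l e = ∅-empty (εʳ e (has-∅ l))

  limit-≉⁺ : Limit x → ¬ x ≈ y ⁺
  limit-≉⁺ {x} {y} l e = ε-irrefl x (εˡ (≈-sym e) (has-⁺ l {y} (εʳ (≈-sym e) ⁺-new)))

  ⁺-≉∅ : ¬ x ⁺ ≈ ∅
  ⁺-≉∅ e = ∅-empty (εʳ e ⁺-new)

  ⁺-inj : x ⁺ ≈ y ⁺ → x ≈ y
  ⁺-inj e with ⁺-elim (εʳ e ⁺-new) | ⁺-elim (εʳ (≈-sym e) ⁺-new)
  ... | inj₂ p | _      = p
  ... | inj₁ p | inj₂ q = ≈-sym q
  ... | inj₁ p | inj₁ q = ⊥-elim (ε-asym p q)

  numeral-inj : ∀ {m n} → numeral m ≈ numeral n → m ≡ n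
  numeral-inj {zero}  {zero}  e = refl
  numeral-inj {zero}  {suc n} e = ⊥-elim (⁺-≉∅ (≈-sym e))
  numeral-inj {suc m} {zero}  e = ⊥-elim (⁺-≉∅ e)
  numeral-inj {suc m} {suc n} e = cong suc (numeral-inj (⁺-inj e))

  numeral-limit : Limit x → ∀ n → numeral n ε x
  numeral-limit l zero    = has-∅ l
  numeral-limit l (suc n) = has-⁺ l (numeral-limit l n)

  ord-numeral : ∀ n → Ord (numeral n)
  ord-numeral zero    = ord-∅
  ord-numeral (suc n) = ord-⁺ (ord-numeral n)

  numeral-not-limit : ∀ n → ¬ Limit (numeral n)
  numeral-not-limit zero    l = limit-≉∅ l ≈-refl
  numeral-not-limit (suc n) l = limit-≉⁺ l ≈-refl

  ω : V
  ω = sup ℕ numeral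

  ω-elim : x ε ω → ∃[ n ] x ≈ numeral n
  ω-elim (mk (n , e)) = n , e

  limit-ω : Limit ω
  limit-ω = record
    { isOrd = record
      { trans₀ = λ m n → let k , e = ω-elim m in below k (εʳ e n)
      ; trans₁ = λ m n p → let k , e = ω-elim m in
          εʳ (≈-sym e) (trans₀ (ord-numeral k) (εʳ e n) p) }
    ; has-∅ = mk (zero , ≈-refl)
    ; has-⁺ = λ m → let k , e = ω-elim m in mk (suc k , ⁺-cong e) }
    where
    below : ∀ k {z} → z ε numeral k → z ε ω
    below zero    m = ⊥-elim (∅-empty m)
    below (suc k) m = [ below k , (λ e → mk (k , e)) ]′ (⁺-elim m)

  -- Constructible sets

  record Con (x : V) : Set₁ where
    constructor mkCon
    field
      stage   : V
      ord     : Ord stage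
      appears : x ε L stage

  open Con public

  fromConstructible : IsConstructible x → Con x
  fromConstructible (β , o , m) = mkCon β (fromOrdinal o) (mk m)

  toConstructible : Con x → IsConstructible x
  toConstructible (mkCon β o m) = β , toOrdinal o , un m

  L-trans : Ord a → y ε L a → z ε y → z ε L a
  L-trans o m n = let b , p , q = L-elim m in (n ▹ Def-⊑ q) ▹ L-mono (ord-⊑ o p)

  con-ε : Con y → z ε y → Con z
  con-ε (mkCon β o m) n = mkCon β o (L-trans o m n)

  con-≈ : x ≈ y → Con x → Con y
  con-≈ e (mkCon β o m) = mkCon β o (εˡ e m)

  -- Formulas over L, with constants from L

  data Term (n : ℕ) : Set₁ where
    var : Fin n → Term n
    con : (a : V) → Con a → Term n

  data Fm (n : ℕ) : Set₁ where
    mem eq : Term n → Term n → Fm n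
    neg    : Fm n → Fm n
    and    : Fm n → Fm n → Fm n
    ex     : Fm (suc n) → Fm n

  Env : ℕ → Set₁
  Env zero    = ⊤
  Env (suc n) = Env n × V

  get : Fin n → Env n → V
  get zero    γ = proj₂ γ
  get (suc i) γ = get i (proj₁ γ)

  ⟦_⟧ₜ : Term n → Env n → V
  ⟦ var i ⟧ₜ   γ = get i γ
  ⟦ con a _ ⟧ₜ γ = a

  -- Truth in the class L. It can be defined by recursion on formulas because its values live in
  -- `Set₁`, one level above those of `Sat`.
  ⟦_⟧ : Fm n → Env n → Set₁
  ⟦ mem t u ⟧ γ = Lift _ (⟦ t ⟧ₜ γ ε ⟦ u ⟧ₜ γ)
  ⟦ eq t u ⟧  γ = Lift _ (⟦ t ⟧ₜ γ ≈ ⟦ u ⟧ₜ γ)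
  ⟦ neg φ ⟧   γ = ¬ ⟦ φ ⟧ γ
  ⟦ and φ ψ ⟧ γ = ⟦ φ ⟧ γ × ⟦ ψ ⟧ γ
  ⟦ ex φ ⟧    γ = ∃[ y ] Con y × ⟦ φ ⟧ (γ , y)

  ⟦⟧ₜ-cong : (t : Term n) {γ δ : Env n} → (∀ i → get i γ ≈ get i δ) → ⟦ t ⟧ₜ γ ≈ ⟦ t ⟧ₜ δ
  ⟦⟧ₜ-cong (var i)   h = h i
  ⟦⟧ₜ-cong (con a _) h = ≈-refl

  ⟦⟧-cong : (φ : Fm n) {γ δ : Env n} → (∀ i → get i γ ≈ get i δ) → ⟦ φ ⟧ γ → ⟦ φ ⟧ δ
  ⟦⟧-cong (mem t u) h (lift p) = lift (εʳ (⟦⟧ₜ-cong u h) (εˡ (⟦⟧ₜ-cong t h) p))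
  ⟦⟧-cong (eq t u)  h (lift p) = lift (≈-trans (≈-sym (⟦⟧ₜ-cong t h)) (≈-trans p (⟦⟧ₜ-cong u h)))
  ⟦⟧-cong (neg φ)   h p q = p (⟦⟧-cong φ (≈-sym ∘ h) q)
  ⟦⟧-cong (and φ ψ) h (p , q) = ⟦⟧-cong φ h p , ⟦⟧-cong ψ h q
  ⟦⟧-cong (ex φ)    h (y , c , p) = y , c , ⟦⟧-cong φ (λ { zero → ≈-refl ; (suc i) → h i }) p

  -- Constants are counted by occurrence: one that is used twice becomes two parameters of the
  -- translated formula.
  countₜ : Term n → ℕ
  countₜ (var _)   = 0
  countₜ (con _ _) = 1

  count : Fm n → ℕ
  count (mem t u) = countₜ t + countₜ u
  count (eq t u)  = countₜ t + countₜ u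
  count (neg φ)   = count φ
  count (and φ ψ) = count φ + count ψ
  count (ex φ)    = count φ

  constₜ : (t : Term n) → Fin (countₜ t) → Σ V Con
  constₜ (con a c) _ = a , c

  constant : (φ : Fm n) → Fin (count φ) → Σ V Con
  constant (mem t u) o = [ constₜ t , constₜ u ]′ (splitAt (countₜ t) o)
  constant (eq t u)  o = [ constₜ t , constₜ u ]′ (splitAt (countₜ t) o)
  constant (neg φ)   o = constant φ o
  constant (and φ ψ) o = [ constant φ , constant ψ ]′ (splitAt (count φ) o)
  constant (ex φ)    o = constant φ o

  -- Variables and constants of φ become variables of the translation.
  translateₜ : (t : Term n) → (Fin n → Fin k) → (Fin (countₜ t) → Fin k) → Fin k
  translateₜ (var i)   v c = v i
  translateₜ (con _ _) v c = c zero

  under : (Fin n → Fin k) → Fin (suc n) → Fin (suc k)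
  under v zero    = zero
  under v (suc i) = suc (v i)

  translate : (φ : Fm n) → (Fin n → Fin k) → (Fin (count φ) → Fin k) → Formula k
  translate (mem t u) v c = translateₜ t v (c ∘ (_↑ˡ countₜ u)) ∈ᶠ translateₜ u v (c ∘ (countₜ t ↑ʳ_))
  translate (eq t u)  v c = translateₜ t v (c ∘ (_↑ˡ countₜ u)) ≈ᶠ translateₜ u v (c ∘ (countₜ t ↑ʳ_))
  translate (neg φ)   v c = ¬ᶠ translate φ v c
  translate (and φ ψ) v c = translate φ v (c ∘ (_↑ˡ count ψ)) ∧ᶠ translate ψ v (c ∘ (count φ ↑ʳ_))
  translate (ex φ)    v c = ∃ᶠ translate φ (under v) (suc ∘ c)

  -- Reflection

  -- The Tarski-Vaught condition for `L δ` inside L, restricted to the subformulas of the given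
  -- formula.
  Closed : Fm n → V → Set₁
  Closed (mem t u) δ = ⊤
  Closed (eq t u)  δ = ⊤
  Closed (neg φ)   δ = Closed φ δ
  Closed (and φ ψ) δ = Closed φ δ × Closed ψ δ
  Closed (ex φ)    δ = Closed φ δ ×
    (∀ γ → (∀ i → get i γ ε L δ) → ⟦ ex φ ⟧ γ → ∃[ y ] y ε L δ × ⟦ φ ⟧ (γ , y))

  module Reflect (δ : V) (oδ : Ord δ) where

    at : Vec (index (L δ)) k → Fin k → V
    at ρ i = element (L δ) (lookup ρ i)

    reflectₜ : (t : Term n) (v : Fin n → Fin k) (c : Fin (countₜ t) → Fin k)
               (ρ : Vec (index (L δ)) k) (γ : Env n) →
               (∀ i → at ρ (v i) ≈ get i γ) → (∀ o → at ρ (c o) ≈ proj₁ (constₜ t o)) →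
               at ρ (translateₜ t v c) ≈ ⟦ t ⟧ₜ γ
    reflectₜ (var i)   v c ρ γ hv hc = hv i
    reflectₜ (con a _) v c ρ γ hv hc = hc zero

    module _ {m m′ : ℕ} (f : Fin m → Σ V Con) (g : Fin m′ → Σ V Con)
             (c : Fin (m + m′) → Fin k) (ρ : Vec (index (L δ)) k)
             (h : ∀ o → at ρ (c o) ≈ proj₁ ([ f , g ]′ (splitAt m o))) where

      onˡ : ∀ o → at ρ (c (o ↑ˡ m′)) ≈ proj₁ (f o)
      onˡ o = subst (λ s → at ρ (c (o ↑ˡ m′)) ≈ proj₁ ([ f , g ]′ s)) (splitAt-↑ˡ m o m′) (h (o ↑ˡ m′))

      onʳ : ∀ o → at ρ (c (m ↑ʳ o)) ≈ proj₁ (g o)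
      onʳ o = subst (λ s → at ρ (c (m ↑ʳ o)) ≈ proj₁ ([ f , g ]′ s)) (splitAt-↑ʳ m m′ o) (h (m ↑ʳ o))

    -- Induction on `φ`. Closure enters only where an existential true in L has to be witnessed
    -- inside `L δ`.
    reflect : (φ : Fm n) → Closed φ δ →
              (v : Fin n → Fin k) (c : Fin (count φ) → Fin k)
              (ρ : Vec (index (L δ)) k) (γ : Env n) →
              (∀ i → at ρ (v i) ≈ get i γ) → (∀ o → at ρ (c o) ≈ proj₁ (constant φ o)) →
              Sat (L δ) (translate φ v c) ρ ⟺ ⟦ φ ⟧ γ
    reflect (mem t u) cl v c ρ γ hv hc = mk⟺
      (λ p → lift (εʳ eu (εˡ et (mk p))))
      (λ (lift p) → un (εʳ (≈-sym eu) (εˡ (≈-sym et) p)))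
      where
      et = reflectₜ t v _ ρ γ hv (onˡ (constₜ t) (constₜ u) c ρ hc)
      eu = reflectₜ u v _ ρ γ hv (onʳ (constₜ t) (constₜ u) c ρ hc)
    reflect (eq t u) cl v c ρ γ hv hc = mk⟺
      (λ p → lift (≈-trans (≈-sym et) (≈-trans p eu)))
      (λ (lift p) → ≈-trans et (≈-trans p (≈-sym eu)))
      where
      et = reflectₜ t v _ ρ γ hv (onˡ (constₜ t) (constₜ u) c ρ hc)
      eu = reflectₜ u v _ ρ γ hv (onʳ (constₜ t) (constₜ u) c ρ hc)
    reflect (neg φ) cl v c ρ γ hv hc = mk⟺ (λ p q → p (from ih q)) (λ p q → p (to ih q))
      where ih = reflect φ cl v c ρ γ hv hc
    reflect (and φ ψ) (cl , cl′) v c ρ γ hv hc = mk⟺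
      (λ (p , q) → to ih p , to ih′ q) (λ (p , q) → from ih p , from ih′ q)
      where
      ih  = reflect φ cl v _ ρ γ hv (onˡ (constant φ) (constant ψ) c ρ hc)
      ih′ = reflect ψ cl′ v _ ρ γ hv (onʳ (constant φ) (constant ψ) c ρ hc)
    reflect (ex φ) (cl , wit) v c ρ γ hv hc = mk⟺
      (λ (i , p) → element (L δ) i , mkCon δ oδ (elem (L δ) i) , to (ih i _ ≈-refl) p)
      (λ p → let y , m , q = wit γ (λ i → εˡ (hv i) (elem (L δ) (lookup ρ (v i)))) p
                 i , e = un m
             in i , from (ih i y (≈-sym e)) q)
      where
      ih : ∀ i y → element (L δ) i ≈ y → Sat (L δ) (translate φ (under v) (suc ∘ c)) (i ∷ ρ) ⟺ ⟦ φ ⟧ (γ , y)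
      ih i y e = reflect φ cl (under v) (suc ∘ c) (i ∷ ρ) (γ , y)
                   (λ { zero → e ; (suc j) → hv j }) hc

  envOf : (x : V) → Vec (index x) n → Env n
  envOf x []      = tt
  envOf x (i ∷ ρ) = envOf x ρ , element x i

  toVec : (x : V) (γ : Env n) → (∀ i → get i γ ε x) → Vec (index x) n
  toVec {zero}  x γ h = []
  toVec {suc n} x γ h = proj₁ (un (h zero)) ∷ toVec x (proj₁ γ) (h ∘ suc)

  envOf-toVec : (x : V) (γ : Env n) (h : ∀ i → get i γ ε x) → ∀ i → get i γ ≈ get i (envOf x (toVec x γ h))
  envOf-toVec x γ h zero    = proj₂ (un (h zero))
  envOf-toVec x γ h (suc i) = envOf-toVec x (proj₁ γ) (h ∘ suc) i

  -- A positive decision carries a witness, so excluded middle also does the choosing. Without a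
  -- witness the stage is the default `∅`, which adds nothing to the union in `witnesses`.
  witnessStage : (φ : Fm (suc n)) (γ : Env n) → Dec (⟦ ex φ ⟧ γ) → V
  witnessStage φ γ (yes (y , c , _)) = stage c
  witnessStage φ γ (no _)            = ∅

  ord-witnessStage : (φ : Fm (suc n)) (γ : Env n) (d : Dec (⟦ ex φ ⟧ γ)) → Ord (witnessStage φ γ d)
  ord-witnessStage φ γ (yes (y , c , _)) = ord c
  ord-witnessStage φ γ (no _)            = ord-∅

  witness-appears : (φ : Fm (suc n)) (γ : Env n) (d : Dec (⟦ ex φ ⟧ γ)) → ⟦ ex φ ⟧ γ →
                    ∃[ y ] y ε L (witnessStage φ γ d) × ⟦ φ ⟧ (γ , y)
  witness-appears φ γ (yes (y , c , p)) _ = y , appears c , p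
  witness-appears φ γ (no ¬p) p = ⊥-elim (¬p p)

  witnesses : (φ : Fm (suc n)) → V → V
  witnesses φ β = ⋃ᵢ λ ρ → witnessStage φ (envOf (L β) ρ) em

  -- A stage at which every existential subformula with parameters from L β
  -- has a witness, if it has one at all.
  skolem : Fm n → V → V
  skolem (mem t u) β = ∅
  skolem (eq t u)  β = ∅
  skolem (neg φ)   β = skolem φ β
  skolem (and φ ψ) β = skolem φ β ∪ skolem ψ β
  skolem (ex φ)    β = skolem φ β ∪ witnesses φ β

  ord-skolem : (φ : Fm n) (β : V) → Ord (skolem φ β)
  ord-skolem (mem t u) β = ord-∅
  ord-skolem (eq t u)  β = ord-∅
  ord-skolem (neg φ)   β = ord-skolem φ β
  ord-skolem (and φ ψ) β = ord-∪ (ord-skolem φ β) (ord-skolem ψ β)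
  ord-skolem (ex φ)    β = ord-∪ (ord-skolem φ β)
    (ord-⋃ {g = λ ρ → witnessStage φ (envOf (L β) ρ) em} λ ρ → ord-witnessStage φ (envOf (L β) ρ) em)

  module _ (s : ℕ → V) (mono : ∀ {m n} → m ≤ n → s m ⊑ s n) where

    common-stage : ∀ n (γ : Env n) → (∀ i → get i γ ε L (⋃ᵢ s)) → ∃[ m ] ∀ i → get i γ ε L (s m)
    common-stage zero    γ h = 0 , λ ()
    common-stage (suc n) γ h =
      let m , p = common-stage n (proj₁ γ) (h ∘ suc)
          b , q , r = L-elim (h zero)
          m′ , q′ = ⋃-elim s q
      in m ℕ.⊔ m′ , λ { zero → L-intro q′ r ▹ L-mono (mono (ℕ.m≤n⊔m m m′))
                      ; (suc i) → p i ▹ L-mono (mono (ℕ.m≤m⊔n m m′)) }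

    -- An environment has finitely many entries, so all of them lie in some `L (s m)` already, and a
    -- witness for them appears by stage `s (suc m)`. Hence ω steps suffice.
    closed-limit : (φ : Fm n) → (∀ m → skolem φ (s m) ⊑ s (suc m)) → Closed φ (⋃ᵢ s)
    closed-limit (mem t u) h = tt
    closed-limit (eq t u)  h = tt
    closed-limit (neg φ)   h = closed-limit φ h
    closed-limit (and φ ψ) h = closed-limit φ (λ m → ⊑-trans ⊑-∪ˡ (h m)) ,
                               closed-limit ψ (λ m → ⊑-trans ⊑-∪ʳ (h m))
    closed-limit (ex φ)    h = closed-limit φ (λ m → ⊑-trans ⊑-∪ˡ (h m)) , λ γ hγ p →
      let m , q = common-stage _ γ hγ
          -- Witnesses were collected along index vectors, so `γ` is replaced by an environment that
          -- equals it entry by entry.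
          ρ = toVec (L (s m)) γ q
          e = envOf-toVec (L (s m)) γ q
          y , r , t = witness-appears φ (envOf (L (s m)) ρ) em (⟦⟧-cong (ex φ) e p)
          into : witnesses φ (s m) ⊑ ⋃ᵢ s
          into = ⊑-trans (⊑-trans ⊑-∪ʳ (h m)) (⊑-intro λ _ → ⋃-intro s (suc m))
      in y , (r ▹ L-mono (⊑-trans (⊑-intro λ _ → ⋃-intro (λ ρ → witnessStage φ (envOf (L (s m)) ρ) em) ρ) into)) ,
         ⟦⟧-cong φ (λ { zero → ≈-refl ; (suc i) → ≈-sym (e i) }) t

  skolemChain : Fm n → V → ℕ → V
  skolemChain φ δ zero    = δ
  skolemChain φ δ (suc m) = skolemChain φ δ m ∪ skolem φ (skolemChain φ δ m)

  reflection : (φ : Fm n) → Ord a → ∃[ δ ] Ord δ × a ⊑ δ × Closed φ δ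
  reflection {a = a} φ o = ⋃ᵢ s , ord-⋃ os , ⊑-intro (λ _ → ⋃-intro s 0) ,
    closed-limit s (mono ∘ ℕ.≤⇒≤′) φ (λ m → ⊑-∪ʳ)
    where
    s = skolemChain φ a
    os : ∀ m → Ord (s m)
    os zero    = o
    os (suc m) = ord-∪ (os m) (ord-skolem φ (s m))
    mono : ∀ {m n} → m ℕ.≤′ n → s m ⊑ s n
    mono (ℕ.≤′-reflexive refl) = ⊑-refl
    mono (ℕ.≤′-step l) = ⊑-trans (mono l) ⊑-∪ˡ

  -- The family `g` belongs to the surrounding universe and serves to find one ordinal `δ₀` by which
  -- all candidates have appeared, together with the constants of `φ`. At a reflecting `δ` above it
  -- the class is first-order definable over `L δ`, hence an element of `L (δ ⁺)`.
  fm-comprehension : (φ : Fm 1) {I : Set} (g : I → V) → (∀ i → Con (g i)) →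
                     (∀ z → Con z → ⟦ φ ⟧ (tt , z) → ∃[ i ] z ≈ g i) →
                     ∃[ s ] Con s × (∀ z → z ε s ⟺ (Con z × ⟦ φ ⟧ (tt , z)))
  fm-comprehension φ {I} g cg bound =
    s , mkCon (δ ⁺) (ord-⁺ oδ) (L-intro ⁺-new (definable-ε ψ ρ)) , λ z → mk⟺
      (λ m → let i , e , p = definable-elim ψ m in
         con-≈ (≈-sym e) (mkCon δ oδ (elem (L δ) i)) , to (spec i z (≈-sym e)) p)
      (λ (cz , p) →
         let j , e = bound z cz p
             i , e′ = un (appears (cg j) ▹ L-mono (⊑-trans (⊑-trans (⊑-intro λ _ → ⋃-intro (stage ∘ cg) j) ⊑-∪ˡ) δ₀⊑δ))
             e″ = ≈-trans e e′
         in definable-intro ψ i e″ (from (spec i z (≈-sym e″)) p))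
    where
    stage-const : Fin (count φ) → V
    stage-const o = stage (proj₂ (constant φ o))
    δ₀ : V
    δ₀ = ⋃ᵢ (stage ∘ cg) ∪ ⋃ᵢ stage-const
    r = reflection {a = δ₀} φ (ord-∪ (ord-⋃ {g = stage ∘ cg} (ord ∘ cg))
                                     (ord-⋃ {g = stage-const} λ o → ord (proj₂ (constant φ o))))
    δ = proj₁ r
    oδ = proj₁ (proj₂ r)
    δ₀⊑δ = proj₁ (proj₂ (proj₂ r))
    locate : ∀ o → proj₁ (constant φ o) ε L δ
    locate o = appears (proj₂ (constant φ o)) ▹
      L-mono (⊑-trans (⊑-trans (⊑-intro λ _ → ⋃-intro stage-const o) ⊑-∪ʳ) δ₀⊑δ)
    ρ : Vec (index (L δ)) (count φ)
    ρ = tabulate λ o → proj₁ (un (locate o))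
    ψ : Formula (suc (count φ))
    ψ = translate φ (λ _ → zero) suc
    s = definable (L δ) ψ ρ
    spec : ∀ i z → element (L δ) i ≈ z → Sat (L δ) ψ (i ∷ ρ) ⟺ ⟦ φ ⟧ (tt , z)
    spec i z e = Reflect.reflect δ oδ φ (proj₂ (proj₂ (proj₂ r))) (λ _ → zero) suc (i ∷ ρ) (tt , z)
      (λ { zero → e })
      (λ o → subst (λ j → element (L δ) j ≈ proj₁ (constant φ o))
               (sym (lookup∘tabulate (λ o → proj₁ (un (locate o))) o))
               (≈-sym (proj₂ (un (locate o)))))

  -- Definable predicates

  ConEnv : Env n → Set₁
  ConEnv γ = ∀ i → Con (get i γ)

  infixl 5 _▸_
  _▸_ : {γ : Env n} → ConEnv γ → Con y → ConEnv {suc n} (γ , y)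
  (h ▸ c) zero    = c
  (h ▸ c) (suc i) = h i

  record Tm (n : ℕ) (t : Env n → V) : Set₁ where
    field
      term : Term n
      spec : ∀ γ → ⟦ term ⟧ₜ γ ≡ t γ

  open Tm

  -- The equivalence is asked at constructible environments only. There the elements of a term are
  -- constructible too, so bounded quantifiers over `V` and over L agree.
  record Definable (n : ℕ) (A : Env n → Set ℓ) : Set (lsuc 0ℓ ⊔ ℓ) where
    field
      fm : Fm n
      ok : ∀ γ → ConEnv γ → ⟦ fm ⟧ γ ⟺ A γ

  open Definable

  v₀ : Tm (suc n) proj₂
  v₀ = record { term = var zero ; spec = λ _ → refl }

  wkₜ : Term n → Term (suc n)
  wkₜ (var i)   = var (suc i)
  wkₜ (con a c) = con a c

  ↑ : {t : Env n → V} → Tm n t → Tm (suc n) (t ∘ proj₁)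
  ↑ {t = t} T = record { term = wkₜ (term T) ; spec = λ γ → trans (wk-spec (term T) γ) (spec T (proj₁ γ)) }
    where
    wk-spec : (u : Term n) (γ : Env (suc n)) → ⟦ wkₜ u ⟧ₜ γ ≡ ⟦ u ⟧ₜ (proj₁ γ)
    wk-spec (var i)   γ = refl
    wk-spec (con a c) γ = refl

  ! : Con a → Tm n (λ _ → a)
  ! c = record { term = con _ c ; spec = λ _ → refl }

  con-tm : {t : Env n → V} → Tm n t → ∀ {γ} → ConEnv γ → Con (t γ)
  con-tm {n} T {γ} h = subst Con (spec T γ) (go (term T))
    where
    go : (u : Term n) → Con (⟦ u ⟧ₜ γ)
    go (var i)   = h i
    go (con a c) = c

  dmap : {A : Env n → Set ℓ} {B : Env n → Set ℓ′} →
         Definable n A → (∀ γ → ConEnv γ → A γ ⟺ B γ) → Definable n B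
  dmap d e = record { fm = fm d ; ok = λ γ h → mk⟺ (to (e γ h) ∘ to (ok d γ h)) (from (ok d γ h) ∘ from (e γ h)) }

  dε : {s t : Env n → V} → Tm n s → Tm n t → Definable n (λ γ → s γ ε t γ)
  dε S T = record { fm = mem (term S) (term T) ; ok = λ γ _ → go γ }
    where
    go : ∀ γ → Lift _ (⟦ term S ⟧ₜ γ ε ⟦ term T ⟧ₜ γ) ⟺ _
    go γ rewrite spec S γ | spec T γ = mk⟺ lower lift

  d≈ : {s t : Env n → V} → Tm n s → Tm n t → Definable n (λ γ → s γ ≈ t γ)
  d≈ S T = record { fm = eq (term S) (term T) ; ok = λ γ _ → go γ }
    where
    go : ∀ γ → Lift _ (⟦ term S ⟧ₜ γ ≈ ⟦ term T ⟧ₜ γ) ⟺ _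
    go γ rewrite spec S γ | spec T γ = mk⟺ lower lift

  d¬ : {A : Env n → Set ℓ} → Definable n A → Definable n (λ γ → ¬ A γ)
  d¬ d = record { fm = neg (fm d) ; ok = λ γ h → mk⟺ (_∘ from (ok d γ h)) (_∘ to (ok d γ h)) }

  infixr 6 _d×_
  infixr 5 _d⊎_
  infixr 4 _d→_

  _d×_ : {A : Env n → Set ℓ} {B : Env n → Set ℓ′} →
         Definable n A → Definable n B → Definable n (λ γ → A γ × B γ)
  d d× e = record { fm = and (fm d) (fm e) ; ok = λ γ h → mk⟺
    (λ (p , q) → to (ok d γ h) p , to (ok e γ h) q)
    (λ (p , q) → from (ok d γ h) p , from (ok e γ h) q) }

  _d⊎_ : {A : Env n → Set ℓ} {B : Env n → Set ℓ′} →
         Definable n A → Definable n B → Definable n (λ γ → A γ ⊎ B γ)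
  d d⊎ e = record { fm = neg (and (neg (fm d)) (neg (fm e))) ; ok = λ γ h → mk⟺
    (λ p → [ inj₁ ∘ to (ok d γ h) , inj₂ ∘ to (ok e γ h) ]′
             (¬¬-elim λ r → p ((λ q → r (inj₁ q)) , (λ q → r (inj₂ q)))))
    [ (λ p (q , _) → q (from (ok d γ h) p)) , (λ p (_ , q) → q (from (ok e γ h) p)) ]′ }

  _d→_ : {A : Env n → Set ℓ} {B : Env n → Set ℓ′} →
         Definable n A → Definable n B → Definable n (λ γ → A γ → B γ)
  d d→ e = record { fm = neg (and (fm d) (neg (fm e))) ; ok = λ γ h → mk⟺
    (λ p a → to (ok e γ h) (¬¬-elim λ q → p (from (ok d γ h) a , q)))
    (λ f (p , q) → q (from (ok e γ h) (f (to (ok d γ h) p)))) }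

  d∃ : {A : Env n → V → Set ℓ} → Definable (suc n) (λ γ → A (proj₁ γ) (proj₂ γ)) →
       Definable n (λ γ → ∃[ y ] Con y × A γ y)
  d∃ d = record { fm = ex (fm d) ; ok = λ γ h → mk⟺
    (λ (y , c , p) → y , c , to (ok d (γ , y) (h ▸ c)) p)
    (λ (y , c , p) → y , c , from (ok d (γ , y) (h ▸ c)) p) }

  d∃∈ : {t : Env n → V} {A : Env n → V → Set ℓ} → Tm n t →
        Definable (suc n) (λ γ → A (proj₁ γ) (proj₂ γ)) →
        Definable n (λ γ → ∃[ y ] y ε t γ × A γ y)
  d∃∈ T d = dmap (d∃ (dε v₀ (↑ T) d× d)) (λ γ h → mk⟺
    (λ (y , _ , m , p) → y , m , p)
    (λ (y , m , p) → y , con-ε (con-tm T {γ} h) m , m , p))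

  d∀∈ : {t : Env n → V} {A : Env n → V → Set ℓ} → Tm n t →
        Definable (suc n) (λ γ → A (proj₁ γ) (proj₂ γ)) →
        Definable n (λ γ → ∀ y → y ε t γ → A γ y)
  d∀∈ T d = record { fm = fm e ; ok = λ γ h → mk⟺
    (λ p y m → let c = con-ε (con-tm T {γ} h) m in
       to (ok d (γ , y) (h ▸ c)) (¬¬-elim λ q → to (ok e γ h) p (y , m , λ r → q (from (ok d (γ , y) (h ▸ c)) r))))
    (λ f → from (ok e γ h) λ (y , m , q) → q (f y m)) }
    where e = d¬ (d∃∈ T (d¬ d))

  dFin∃ : {A : Fin m → Env n → Set ℓ} → (∀ j → Definable n (A j)) → Definable n (λ γ → ∃[ j ] A j γ)
  dFin∃ {zero} d = record { fm = ex (neg (eq (var zero) (var zero))) ; ok = λ γ h → mk⟺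
    (λ (y , _ , p) → ⊥-elim (p (lift ≈-refl))) (λ ()) }
  dFin∃ {suc m} d = dmap (d zero d⊎ dFin∃ (d ∘ suc)) (λ γ h → mk⟺
    [ (λ p → zero , p) , (λ (j , p) → suc j , p) ]′
    (λ { (zero , p) → inj₁ p ; (suc j , p) → inj₂ (j , p) }))

  dFin∀ : {A : Fin m → Env n → Set ℓ} → (∀ j → Definable n (A j)) → Definable n (λ γ → ∀ j → A j γ)
  dFin∀ {zero} d = record { fm = neg (ex (neg (eq (var zero) (var zero)))) ; ok = λ γ h → mk⟺
    (λ _ ()) (λ _ (y , _ , p) → ⊥-elim (p (lift ≈-refl))) }
  dFin∀ {suc m} d = dmap (d zero d× dFin∀ (d ∘ suc)) (λ γ h → mk⟺
    (λ { (p , f) zero → p ; (p , f) (suc j) → f j })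
    (λ f → f zero , λ j → f (suc j)))

  -- Definability in all contexts and at all terms, which replaces substitution into formulas.
  Definable₁ : (V → Set ℓ) → Set (lsuc 0ℓ ⊔ ℓ)
  Definable₁ A = ∀ {n} {s : Env n → V} → Tm n s → Definable n (λ γ → A (s γ))

  Definable₂ : (V → V → Set ℓ) → Set (lsuc 0ℓ ⊔ ℓ)
  Definable₂ A = ∀ {n} {s t : Env n → V} → Tm n s → Tm n t → Definable n (λ γ → A (s γ) (t γ))

  Definable₃ : (V → V → V → Set ℓ) → Set (lsuc 0ℓ ⊔ ℓ)
  Definable₃ A = ∀ {n} {s t u : Env n → V} → Tm n s → Tm n t → Tm n u →
                 Definable n (λ γ → A (s γ) (t γ) (u γ))

  -- Truth of a formula is invariant under `_≈_`, so every definable predicate inherits this on L.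
  definable-resp : {A : V → Set ℓ} → Definable₁ A → Con x → x ≈ y → A x → A y
  definable-resp {x = x} {y} d c e p =
    to (ok d₀ (tt , y) (λ { zero → con-≈ e c }))
       (⟦⟧-cong (fm d₀) (λ { zero → e }) (from (ok d₀ (tt , x) (λ { zero → c })) p))
    where d₀ = d v₀

  abstract
    comprehension : (A : V → Set ℓ) → Definable₁ A → {I : Set} (g : I → V) → (∀ i → Con (g i)) →
                    (∀ z → Con z → A z → ∃[ i ] z ≈ g i) →
                    ∃[ s ] Con s × (∀ z → z ε s ⟺ (Con z × A z))
    comprehension A d g cg bound =
      let d₀ = d v₀
          s , cs , h = fm-comprehension (fm d₀) g cg λ z c p → bound z c (to (ok d₀ (tt , z) λ { zero → c }) p)
      in s , cs , λ z → mk⟺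
        (λ m → let c , p = to (h z) m in c , to (ok d₀ (tt , z) λ { zero → c }) p)
        (λ (c , p) → from (h z) (c , from (ok d₀ (tt , z) λ { zero → c }) p))

  con-∅ : Con ∅
  con-∅ =
    let s , c , h = comprehension (λ z → ¬ z ≈ z) (λ S → d¬ (d≈ S S)) {⊥} (λ ()) (λ ()) (λ z _ p → ⊥-elim (p ≈-refl))
    in con-≈ (ext (λ z m → ⊥-elim (proj₂ (to (h z) m) ≈-refl)) (λ z m → ⊥-elim (∅-empty m))) c

  con-upair : Con x → Con y → Con (upair x y)
  con-upair {x} {y} cx cy =
    let s , c , h = comprehension (λ z → z ≈ x ⊎ z ≈ y) (λ S → d≈ S (! cx) d⊎ d≈ S (! cy))
                      (if_then x else y) (λ { true → cx ; false → cy })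
                      (λ z _ → [ (λ e → true , e) , (λ e → false , e) ]′)
    in con-≈ (ext (λ z m → [ (λ e → εˡ (≈-sym e) upair-fst) , (λ e → εˡ (≈-sym e) upair-snd) ]′ (proj₂ (to (h z) m)))
                  (λ z m → from (h z) ([ (λ e → con-≈ (≈-sym e) cx) , (λ e → con-≈ (≈-sym e) cy) ]′ (upair-elim m) , upair-elim m))) c

  con-pair : Con x → Con y → Con (pair x y)
  con-pair cx cy = con-≈ (≈-sym pair-unfold) (con-upair (con-upair cx cx) (con-upair cx cy))

  upair-char : z ≈ upair x y ⟺ (x ε z × y ε z × (∀ w → w ε z → w ≈ x ⊎ w ≈ y))
  upair-char = mk⟺
    (λ e → εʳ (≈-sym e) upair-fst , εʳ (≈-sym e) upair-snd , λ w m → upair-elim (εʳ e m))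
    (λ (p , q , r) → ext
      (λ w m → [ (λ e → εˡ (≈-sym e) upair-fst) , (λ e → εˡ (≈-sym e) upair-snd) ]′ (r w m))
      (λ w m → [ (λ e → εˡ (≈-sym e) p) , (λ e → εˡ (≈-sym e) q) ]′ (upair-elim m)))

  d-upair : Definable₃ (λ z x y → z ≈ upair x y)
  d-upair Z X Y = dmap (dε X Z d× dε Y Z d× d∀∈ Z (d≈ v₀ (↑ X) d⊎ d≈ v₀ (↑ Y))) (λ γ h → let e = upair-char in mk⟺ (from e) (to e))

  d-pair : Definable₃ (λ z x y → z ≈ pair x y)
  d-pair Z X Y = dmap (d∃∈ Z (d∃∈ (↑ Z) (d-upair (↑ v₀) (↑ (↑ X)) (↑ (↑ X)) d× d-upair v₀ (↑ (↑ X)) (↑ (↑ Y)) d×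
                       d-upair (↑ (↑ Z)) (↑ v₀) v₀))) (λ γ h → mk⟺
    (λ (u , _ , v , _ , p , q , r) → ≈-trans r (≈-trans (upair-cong p q) (≈-sym pair-unfold)))
    (λ e → let e′ = ≈-trans e pair-unfold in
      _ , εʳ (≈-sym e′) upair-fst , _ , εʳ (≈-sym e′) upair-snd , ≈-refl , ≈-refl , e′))

  d-pairε : Definable₃ (λ f x y → pair x y ε f)
  d-pairε F X Y = dmap (d∃∈ F (d-pair v₀ (↑ X) (↑ Y))) (λ γ h → mk⟺
    (λ (p , m , e) → εˡ e m) (λ m → _ , m , ≈-refl))

  d-⊑ : Definable₂ _⊑_
  d-⊑ X Y = dmap (d∀∈ X (dε v₀ (↑ Y))) (λ γ h → mk⟺ ⊑-intro (λ s z m → m ▹ s))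

  ⁺-char : z ≈ x ⁺ ⟺ (x ε z × x ⊑ z × (∀ w → w ε z → w ε x ⊎ w ≈ x))
  ⁺-char {z} {x} = mk⟺
    (λ e → εʳ (≈-sym e) ⁺-new , ⊑-trans (x⊑x⁺ {x}) (≈⇒⊑ (≈-sym e)) , λ w m → ⁺-elim {w} {x} (εʳ e m))
    (λ (p , s , r) → ext (λ w m → [ ⁺-old , (λ e → εˡ (≈-sym e) (⁺-new {x})) ]′ (r w m))
                         (λ w m → ⁺-least s p ⊒ m))
    where
    _⊒_ : y ⊑ z → w ε y → w ε z
    s ⊒ m = m ▹ s

  d-⁺ : Definable₂ (λ z x → z ≈ x ⁺)
  d-⁺ Z X = dmap (dε X Z d× d-⊑ X Z d× d∀∈ Z (dε v₀ (↑ X) d⊎ d≈ v₀ (↑ X))) (λ γ h → let e = ⁺-char in mk⟺ (from e) (to e))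

  -- Recursion inside L

  Agreeing : V → (V → V → Set ℓ) → V → V → Set _
  Agreeing B C f t = ∀ s → s ε t → ∀ z → z ε B → pair s z ε f ⟺ C s z

  -- Recursion along an ordinal D of L: the sections of C ⊆ D × B are
  -- determined, through a definable Step, by the earlier ones, so that C can
  -- be read off at t from any set f that obeys Step below t.

  module Recursion
    {D B : V} (cD : Con D) (oD : Ord D) (cB : Con B)
    (C : V → V → Set ℓ)
    (Step : V → V → V → Set ℓ′) (dStep : Definable₃ Step)
    (step-spec : ∀ t → t ε D → ∀ f → Con f → Agreeing B C f t → ∀ z → z ε B → Step f t z ⟺ C t z)
    where

    Agrees : V → V → Set _
    Agrees = Agreeing B C

    Obeys : V → V → Set _
    Obeys f t = ∀ s → s ε t → ∀ z → z ε B → (pair s z ε f → Step f s z) × (Step f s z → pair s z ε f)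

    -- The usual elimination of recursion: some attempt `f` in L obeys `Step` below `t` and yields
    -- `z` at `t`. By `obeys⇒agrees` all attempts give the same answer.
    Computed : V → V → Set _
    Computed t z = ∃[ f ] Con f × Obeys f t × Step f t z

    d-Computed : Definable₂ Computed
    d-Computed T Z = d∃ (d∀∈ (↑ T) (d∀∈ (! cB)
        ((d-pairε (↑ (↑ v₀)) (↑ v₀) v₀ d→ dStep (↑ (↑ v₀)) (↑ v₀) v₀) d×
         (dStep (↑ (↑ v₀)) (↑ v₀) v₀ d→ d-pairε (↑ (↑ v₀)) (↑ v₀) v₀)))
      d× dStep v₀ (↑ T) (↑ Z))

    obeys⇒agrees : ∀ {f t} → t ε D → Con f → Obeys f t → Agrees f t
    obeys⇒agrees {f} {t} tD cf o = ε-induction _ λ s ih sε z zε →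
      let e = step-spec s (trans₀ oD tD sε) f cf (λ r rε → ih r rε (trans₁ oD tD sε rε)) z zε
      in mk⟺ (to e ∘ proj₁ (o s sε z zε)) (proj₂ (o s sε z zε) ∘ from e)

    agrees⇒obeys : ∀ {f t} → t ε D → Con f → Agrees f t → Obeys f t
    agrees⇒obeys {f} tD cf a s sε z zε =
      let e = step-spec s (trans₀ oD tD sε) f cf (λ r rε → a r (trans₁ oD tD sε rε)) z zε
      in from e ∘ to (a s sε z zε) , from (a s sε z zε) ∘ to e

    Below : V → V → Set _
    Below t p = ∃[ s ] s ε t × (∃[ z ] z ε B × p ≈ pair s z × Computed s z)

    d-Below : ∀ {t} → Con t → Definable₁ (Below t)
    d-Below ct P = d∃∈ (! ct) (d∃∈ (! cB) (d-pair (↑ (↑ P)) (↑ v₀) v₀ d× d-Computed (↑ v₀) v₀))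

    below : ∀ {t} → Con t → ∃[ f ] Con f × (∀ p → p ε f ⟺ (Con p × Below t p))
    below {t} ct = comprehension (Below t) (d-Below ct)
      {index t × index B} (λ (i , j) → pair (element t i) (element B j))
      (λ (i , j) → con-pair (con-ε ct (elem t i)) (con-ε cB (elem B j)))
      (λ { p _ (s , mk (i , e) , z , mk (j , e′) , q , _) → (i , j) , ≈-trans q (pair-cong e e′) })

    computed-resp : ∀ {s s′ z z′} → Con s → Con z → s ≈ s′ → z ≈ z′ → Computed s z → Computed s′ z′
    computed-resp {s} {s′} {z} {z′} cs cz e e′ q =
      definable-resp {A = λ s → Computed s z′} (λ S → d-Computed S (! (con-≈ e′ cz))) cs e
        (definable-resp {A = Computed s} (λ Z → d-Computed (! cs) Z) cz e′ q)

    below-agrees : ∀ {t f} → t ε D → (∀ s → s ε t → s ε D → ∀ z → z ε B → Computed s z ⟺ C s z) →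
                   (∀ p → p ε f ⟺ (Con p × Below t p)) → Agrees f t
    below-agrees {t} {f} tD ih h s sε z zε = mk⟺ fwd bwd
      where
      ct = con-ε cD tD
      fwd : pair s z ε f → C s z
      fwd m with to (h _) m
      ... | _ , s′ , s′ε , z′ , z′ε , e , q =
        to (ih s sε (trans₀ oD tD sε) z zε)
          (computed-resp (con-ε ct s′ε) (con-ε cB z′ε) (≈-sym (pair-injˡ e)) (≈-sym (pair-injʳ e)) q)
      bwd : C s z → pair s z ε f
      bwd q = from (h _) (con-pair (con-ε ct sε) (con-ε cB zε) ,
        s , sε , z , zε , ≈-refl , from (ih s sε (trans₀ oD tD sε) z zε) q)

    -- The induction hypothesis makes the set collected by `below` agree with `C` below `t`, so it
    -- is an attempt for `t`. Existence of attempts thus rests on comprehension, with all entries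
    -- taken from the product of `t` and `B`.
    computed⟺ : ∀ t → t ε D → ∀ z → z ε B → Computed t z ⟺ C t z
    computed⟺ = ε-induction _ λ t ih tD z zε → step t tD z zε ih (below (con-ε cD tD))
      where
      step : ∀ t → t ε D → ∀ z → z ε B →
             (∀ s → s ε t → s ε D → ∀ z → z ε B → Computed s z ⟺ C s z) →
             ∃[ f ] Con f × (∀ p → p ε f ⟺ (Con p × Below t p)) → Computed t z ⟺ C t z
      step t tD z zε ih (f , cf , h) = mk⟺
        (λ (g , cg , o , q) → to (step-spec t tD g cg (obeys⇒agrees tD cg o) z zε) q)
        (λ q → f , cf , agrees⇒obeys tD cf agrees , from (step-spec t tD f cf agrees z zε) q)
        where agrees = below-agrees tD ih h

    d-C : Definable₂ (λ t z → t ε D × z ε B × C t z)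
    d-C T Z = dmap (dε T (! cD) d× dε Z (! cB) d× d-Computed T Z) (λ γ h → mk⟺
      (λ (p , q , r) → p , q , to (computed⟺ _ p _ q) r)
      (λ (p , q , r) → p , q , from (computed⟺ _ p _ q) r))

  module Regular (𝛂 : 𝕃) (urc : InL.IsUncountableRegularCardinal 𝛂) where

    -- Collection below a regular cardinal of L

    α : V
    α = proj₁ 𝛂

    con-α : Con α
    con-α = fromConstructible (proj₂ 𝛂)

    inL : (x : V) → Con x → 𝕃
    inL x c = x , toConstructible c

    con𝕃 : (x : 𝕃) → Con (proj₁ x)
    con𝕃 (_ , c) = fromConstructible c

    abstract
      limit-α : Limit α
      limit-α = go (proj₁ (proj₁ (proj₂ urc)))
        where
        go : InL.IsLimit 𝛂 → Limit α
        go ((t , t′) , (y , m) , h) = fromLimit (toOrdinal o , (proj₁ y , m) , succ)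
          where
          o : Ord α
          o = record
            { trans₀ = λ p q → let cy = con-ε con-α p in
                mk (t (inL _ cy) (un p) (inL _ (con-ε cy q)) (un q))
            ; trans₁ = λ p q r → let cy = con-ε con-α p; cz = con-ε cy q in
                mk (t′ (inL _ cy) (un p) (inL _ cz) (un q) (inL _ (con-ε cz r)) (un r)) }
          succ : ∀ y → y ∈ α → ∃[ z ] z ∈ α × y ∈ z
          succ y m = let (z , _) , p , q = h (inL y (con-ε con-α (mk m))) m in z , p , q

      ord-α : Ord α
      ord-α = isOrd limit-α

    -- Functions in L

    isPair-intro : ∀ {p x y : 𝕃} → proj₁ p ≈ pair (proj₁ x) (proj₁ y) → InL.IsPair p x y
    isPair-intro {p , cp} {x , cx} {y , cy} e =
      u , v , unordered {u} {x , cx} {x , cx} ≈-refl , unordered {v} {x , cx} {y , cy} ≈-refl , unordered {p , cp} {u} {v} (≈-trans e pair-unfold)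
      where
      cx′ = fromConstructible cx
      cy′ = fromConstructible cy
      u = inL (upair x x) (con-upair cx′ cx′)
      v = inL (upair x y) (con-upair cx′ cy′)
      unordered : ∀ {p x y : 𝕃} → proj₁ p ≈ upair (proj₁ x) (proj₁ y) → InL.IsUnorderedPair p x y
      unordered {p} {x} {y} e (z , _) = mk⇔
        (λ m → upair-elim (εʳ e (mk m)))
        (λ r → un (εʳ (≈-sym e) ([ (λ e′ → εˡ (≈-sym e′) (upair-fst {proj₁ x} {proj₁ y})) ,
                                   (λ e′ → εˡ (≈-sym e′) (upair-snd {proj₁ y} {proj₁ x})) ]′ r)))

    isPair-elim : ∀ {p x y : 𝕃} → InL.IsPair p x y → proj₁ p ≈ pair (proj₁ x) (proj₁ y)
    isPair-elim {p} {x} {y} (u , v , hu , hv , hp) =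
      ≈-trans (unordered {p} {u} {v} hp) (≈-trans (upair-cong (unordered {u} {x} {x} hu) (unordered {v} {x} {y} hv)) (≈-sym pair-unfold))
      where
      unordered : ∀ {p x y : 𝕃} → InL.IsUnorderedPair p x y → proj₁ p ≈ upair (proj₁ x) (proj₁ y)
      unordered {p} {x} {y} h = ext
        (λ z m → [ (λ e → εˡ (≈-sym e) upair-fst) , (λ e → εˡ (≈-sym e) upair-snd) ]′
                   (Equivalence.to (h (inL z (con-ε (con𝕃 p) m))) (un m)))
        (λ z m → [ (λ e → mk (Equivalence.from (h (inL z (con-≈ (≈-sym e) (con𝕃 x)))) (inj₁ e))) ,
                   (λ e → mk (Equivalence.from (h (inL z (con-≈ (≈-sym e) (con𝕃 y)))) (inj₂ e))) ]′ (upair-elim m))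

    -- The assumptions on `α` speak of functions that are elements of L. A definable functional
    -- relation supplies one, by comprehension within the pairs from `β` and `κ`.
    module Graph
      {β κ : V} (cβ : Con β) (cκ : Con κ)
      (R : V → V → Set₁) (dR : Definable₂ R)
      (total : ∀ a → a ε β → ∃[ b ] b ε κ × R a b)
      (unique : ∀ a b b′ → a ε β → b ε κ → b′ ε κ → R a b → R a b′ → b ≈ b′)
      where

      R-resp : ∀ {a a′ b b′} → Con a → Con b → a ≈ a′ → b ≈ b′ → R a b → R a′ b′
      R-resp {a} {a′} {b} {b′} ca cb e e′ q =
        definable-resp {A = λ a → R a b′} (λ S → dR S (! (con-≈ e′ cb))) ca e
          (definable-resp {A = R a} (λ Z → dR (! ca) Z) cb e′ q)

      Entry : V → Set₁
      Entry p = ∃[ a ] a ε β × (∃[ b ] b ε κ × p ≈ pair a b × R a b)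

      graph : ∃[ f ] Con f × (∀ p → p ε f ⟺ (Con p × Entry p))
      graph = comprehension Entry
        (λ P → d∃∈ (! cβ) (d∃∈ (! cκ) (d-pair (↑ (↑ P)) (↑ v₀) v₀ d× dR (↑ v₀) v₀)))
        {index β × index κ} (λ (i , j) → pair (element β i) (element κ j))
        (λ (i , j) → con-pair (con-ε cβ (elem β i)) (con-ε cκ (elem κ j)))
        (λ { p _ (s , mk (i , e) , z , mk (j , e′) , q , _) → (i , j) , ≈-trans q (pair-cong e e′) })

      f : 𝕃
      f = inL (proj₁ graph) (proj₁ (proj₂ graph))

      f-spec : ∀ p → p ε proj₁ f ⟺ (Con p × Entry p)
      f-spec = proj₂ (proj₂ graph)

      maps-intro : (a b : 𝕃) → proj₁ a ε β → proj₁ b ε κ → R (proj₁ a) (proj₁ b) → InL.Maps f a b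
      maps-intro a b aβ bκ r =
        p , un (from (f-spec (pair (proj₁ a) (proj₁ b))) (cp , proj₁ a , aβ , proj₁ b , bκ , ≈-refl , r)) ,
        isPair-intro {p} {a} {b} ≈-refl
        where
        cp = con-pair (con𝕃 a) (con𝕃 b)
        p = inL (pair (proj₁ a) (proj₁ b)) cp

      entry-elim : ∀ {a b p} → p ≈ pair a b → Entry p → a ε β × b ε κ × R a b
      entry-elim e (a′ , aβ , b′ , bκ , e′ , r) =
        εˡ e₁ aβ , εˡ e₂ bκ , R-resp (con-ε cβ aβ) (con-ε cκ bκ) e₁ e₂ r
        where
        e₁ = pair-injˡ (≈-trans (≈-sym e′) e)
        e₂ = pair-injʳ (≈-trans (≈-sym e′) e)

      maps-elim : (a b : 𝕃) → InL.Maps f a b → proj₁ a ε β × proj₁ b ε κ × R (proj₁ a) (proj₁ b)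
      maps-elim a b (p , m , h) =
        entry-elim (isPair-elim {p} {a} {b} h) (proj₂ (to (f-spec (proj₁ p)) (mk m)))

      isFunction : InL.IsFunction f (inL β cβ) (inL κ cκ)
      isFunction =
        (λ p m → let cp , a , aβ , b , bκ , e , r = to (f-spec (proj₁ p)) (mk m)
                     a′ = inL a (con-ε cβ aβ); b′ = inL b (con-ε cκ bκ)
                 in a′ , b′ , un aβ , un bκ , isPair-intro {p} {a′} {b′} e) ,
        (λ a m → let b , bκ , r = total (proj₁ a) (mk m)
                     b′ = inL b (con-ε cκ bκ)
                 in b′ , un bκ , maps-intro a b′ (mk m) bκ r) ,
        (λ a b b′ p q → let aβ , bκ , r = maps-elim a b p; _ , bκ′ , r′ = maps-elim a b′ q
                        in unique (proj₁ a) (proj₁ b) (proj₁ b′) aβ bκ bκ′ r r′)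

    isLimit-inL : (x : 𝕃) → Limit (proj₁ x) → InL.IsLimit x
    isLimit-inL x l =
      ((λ y m z n → un (trans₀ (isOrd l) (mk m) (mk n))) ,
       (λ y m z n w k → un (trans₁ (isOrd l) (mk m) (mk n) (mk k)))) ,
      (inL ∅ con-∅ , un (has-∅ l)) ,
      λ y m → inL (proj₁ y ⁺) (con-ε (con𝕃 x) (has-⁺ l {proj₁ y} (mk m))) , un (has-⁺ l {proj₁ y} (mk m)) , un (⁺-new {proj₁ y})

    isLimit-fromL : (x : 𝕃) → Ord (proj₁ x) → InL.IsLimit x → Limit (proj₁ x)
    isLimit-fromL x o (_ , (y , m) , h) = fromLimit (toOrdinal o , (proj₁ y , m) , λ y m →
      let (z , _) , p , q = h (inL y (con-ε (con𝕃 x) (mk m))) m in z , p , q)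

    -- Otherwise the identity would be an injection in L from `α` into ω.
    ω≉α : ¬ ω ≈ α
    ω≉α e = proj₂ (proj₂ urc) 𝛂 (isLimit-inL 𝛂 limit-α , finite) (G.f , G.isFunction , injective)
      where
      finite : ∀ v → proj₁ v ∈ α → ¬ InL.IsLimit v
      finite v m l with ω-elim (εʳ (≈-sym e) (mk m))
      ... | n , e′ = numeral-not-limit n (limit-cong e′ (isLimit-fromL v (ord-ε ord-α (mk m)) l))
      lift-unique : Lift (lsuc 0ℓ) (a ≈ b) → Lift (lsuc 0ℓ) (a ≈ c) → b ≈ c
      lift-unique (lift p) (lift q) = ≈-trans (≈-sym p) q
      module G = Graph con-α con-α (λ a b → Lift _ (a ≈ b))
        (λ S T → dmap (d≈ S T) λ γ h → mk⟺ lift lower)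
        (λ a m → a , m , lift ≈-refl) (λ a b b′ _ _ _ p q → lift-unique p q)
      injective : ∀ x x′ y → InL.Maps G.f x y → InL.Maps G.f x′ y → proj₁ x ≈ proj₁ x′
      injective x x′ y p q =
        ≈-trans (lower (proj₂ (proj₂ (G.maps-elim x y p)))) (≈-sym (lower (proj₂ (proj₂ (G.maps-elim x′ y q)))))

    ω-ε-α : ω ε α
    ω-ε-α = go (trichotomy (isOrd limit-ω) ord-α)
      where
      go : ω ε α ⊎ ω ≈ α ⊎ α ε ω → ω ε α
      go (inj₁ m)        = m
      go (inj₂ (inj₁ e)) = ⊥-elim (ω≉α e)
      go (inj₂ (inj₂ m)) =
        let n , e = ω-elim m in ⊥-elim (numeral-not-limit n (limit-cong e limit-α))

    module _ {β : V} (βα : β ε α) (A : V → V → Set₁) (dA : Definable₂ A)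
             (total : ∀ a → a ε β → ∃[ b ] b ε α × A a b) where

      private
        cβ : Con β
        cβ = con-ε con-α βα

        Least : V → V → Set₁
        Least a b = A a b × (∀ c → c ε b → ¬ A a c)

        d-Least : Definable₂ Least
        d-Least S T = dA S T d× d∀∈ T (d¬ (dA (↑ S) v₀))

        least-total : ∀ a → a ε β → ∃[ b ] b ε α × Least a b
        least-total a m = go (least (λ b → b ε α × A a b) (total a m))
          where
          go : ∃[ b ] (b ε α × A a b) × (∀ c → c ε b → ¬ (c ε α × A a c)) → ∃[ b ] b ε α × Least a b
          go (b , (bα , p) , q) = b , bα , p , λ c cb r → q c cb (trans₀ ord-α bα cb , r)

        least-unique : ∀ a b b′ → a ε β → b ε α → b′ ε α → Least a b → Least a b′ → b ≈ b′
        least-unique a b b′ _ bα bα′ (p , q) (p′ , q′)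
          with trichotomy (ord-ε ord-α bα) (ord-ε ord-α bα′)
        ... | inj₁ m        = ⊥-elim (q′ b m p)
        ... | inj₂ (inj₁ e) = e
        ... | inj₂ (inj₂ m) = ⊥-elim (q b′ m p′)

        module G = Graph cβ con-α Least d-Least least-total least-unique

      -- Were there no bound, the map sending a to the least b with A a b
      -- would be cofinal.
      collection : ∃[ g ] g ε α × (∀ a → a ε β → ∃[ b ] b ε g × A a b)
      collection = ¬¬-elim λ unbounded →
        proj₂ (proj₁ (proj₂ urc)) (inL β cβ) (un βα) (G.f , G.isFunction , λ g gα →
          ¬¬-elim λ n → unbounded (proj₁ g , mk gα , λ a aβ → ¬¬-elim λ n′ →
            n (cofinal g (mk gα) a aβ n′ (least-total a aβ))))
        where
        cofinal : (g : 𝕃) → proj₁ g ε α → ∀ a → a ε β → ¬ (∃[ b ] b ε proj₁ g × A a b) →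
                  ∃[ b ] b ε α × Least a b →
                  ∃[ δ ] ∃[ η ] proj₁ δ ∈ β × proj₁ η ∈ α × InL.Maps G.f δ η × g InL.⊆ η
        cofinal g gα a aβ n (b , bα , p) =
          a′ , b′ , un aβ , un bα , G.maps-intro a′ b′ aβ bα p ,
          λ z m → [ (λ bg → ⊥-elim (n (b , bg , proj₁ p))) , (λ s → un (mk m ▹ s)) ]′
                    (ord-split (ord-ε ord-α bα) (ord-ε ord-α gα))
          where
          a′ = inL a (con-ε cβ aβ)
          b′ = inL b (con-ε con-α bα)

    -- Machines

    ≡⇒≈ : x ≡ y → x ≈ y
    ≡⇒≈ refl = ≈-refl

    -- The line is treated as one more component, since it obeys the same limit rule as the
    -- registers and is likewise below `α`.
    component : Configuration k → Fin (suc k) → V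
    component c zero    = numeral (line c)
    component c (suc j) = regs c j

    -- The choice between two formulas is made outside the formulas; in `Effect` it depends on
    -- register indices alone.
    choose : {Q : Set} → Dec Q → Set ℓ → Set ℓ → Set ℓ
    choose (yes _) A B = A
    choose (no _)  A B = B

    choose-map : {Q : Set} (d : Dec Q) {A B A′ B′ : Set ℓ} → (A → A′) → (B → B′) → choose d A B → choose d A′ B′
    choose-map (yes _) f g = f
    choose-map (no _)  f g = g

    d-choose : {Q : Set} (d : Dec Q) {A B : Env n → Set ℓ} → Definable n A → Definable n B →
               Definable n (λ γ → choose d (A γ) (B γ))
    d-choose (yes _) p q = p
    d-choose (no _)  p q = q

    -- The effect of an instruction as a relation: F j b says that b is the
    -- old value of component j, Effect ι x F j a that a is the new one.

    Moves Increments : {k : ℕ} → (Fin k → V → Set) → Fin k → V → Set₁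
    Moves F j a      = ∃[ b ] b ε α × F j b × a ≈ b
    Increments F j a = ∃[ b ] b ε α × F j b × a ≈ b ⁺

    Jumps : (F : Fin (suc k) → V → Set) (i j : Fin k) (l : ℕ) → V → Set₁
    Jumps F i j l a = ∃[ b ] b ε α × F (suc i) b × (∃[ c ] c ε α × F (suc j) c ×
      ((b ≈ c × a ≈ numeral l) ⊎ (¬ b ≈ c × Increments F zero a)))

    Asks : (x : V) (F : Fin (suc k) → V → Set) (i : Fin k) → V → Set₁
    Asks x F i a = ∃[ b ] b ε α × F (suc i) b × ((b ε x × a ≈ numeral 1) ⊎ (¬ b ε x × a ≈ numeral 0))

    Effect : Instruction k → V → (Fin (suc k) → V → Set) → Fin (suc k) → V → Set₁
    Effect (increment i)   x F zero    = Increments F zero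
    Effect (increment i)   x F (suc j) a = choose (j ≟ᶠ i) (Increments F (suc i) a) (Moves F (suc j) a)
    Effect (copy i i′)     x F zero    = Increments F zero
    Effect (copy i i′)     x F (suc j) a = choose (j ≟ᶠ i′) (Moves F (suc i) a) (Moves F (suc j) a)
    Effect (jumpIf≈ i j l) x F zero    = Jumps F i j l
    Effect (jumpIf≈ _ _ _) x F (suc j) = Moves F (suc j)
    Effect (oracle i)      x F zero    = Increments F zero
    Effect (oracle i)      x F (suc j) a = choose (j ≟ᶠ i) (Asks x F i a) (Moves F (suc j) a)

    module _ {F G : Fin (suc k) → V → Set} (h : ∀ j b → b ε α → F j b → G j b) where

      moves-map : ∀ j a → Moves F j a → Moves G j a
      moves-map j a (b , m , p , q) = b , m , h j b m p , q

      increments-map : ∀ j a → Increments F j a → Increments G j a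
      increments-map j a (b , m , p , q) = b , m , h j b m p , q

      asks-map : ∀ x i a → Asks x F i a → Asks x G i a
      asks-map x i a (b , m , p , q) = b , m , h (suc i) b m p , q

      -- All occurrences of `F` in `Effect` are positive.
      effect-map : ∀ ι x j a → Effect ι x F j a → Effect ι x G j a
      effect-map (increment i)   x zero    a = increments-map zero a
      effect-map (increment i)   x (suc j) a = choose-map (j ≟ᶠ i) (increments-map (suc i) a) (moves-map (suc j) a)
      effect-map (copy i i′)     x zero    a = increments-map zero a
      effect-map (copy i i′)     x (suc j) a = choose-map (j ≟ᶠ i′) (moves-map (suc i) a) (moves-map (suc j) a)
      effect-map (jumpIf≈ i j l) x zero    a (b , m , p , c , m′ , p′ , r) =
        b , m , h (suc i) b m p , c , m′ , h (suc j) c m′ p′ ,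
        [ inj₁ , (λ (n , q) → inj₂ (n , increments-map zero a q)) ]′ r
      effect-map (jumpIf≈ _ _ _) x (suc j) a = moves-map (suc j) a
      effect-map (oracle i)      x zero    a = increments-map zero a
      effect-map (oracle i)      x (suc j) a = choose-map (j ≟ᶠ i) (asks-map x i a) (moves-map (suc j) a)

    abstract
      con-numeral : ∀ n → Con (numeral n)
      con-numeral n = con-ε con-α (numeral-limit limit-α n)

    code : Fin k → V → V
    code j a = pair (numeral (toℕ j)) a

    code-inj : {i j : Fin k} → code i a ≈ code j b → i ≡ j × a ≈ b
    code-inj e = toℕ-injective (numeral-inj (pair-injˡ e)) , pair-injʳ e

    -- According to the trace f, component j has the value a at time s.
    At : V → V → Fin k → V → Set
    At f s j a = pair s (code j a) ε f

    d-code : (j : Fin k) → Definable₂ (λ z a → z ≈ code j a)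
    d-code j Z A = d-pair Z (! (con-numeral (toℕ j))) A

    con-code : (j : Fin k) → Con a → Con (code j a)
    con-code j ca = con-pair (con-numeral (toℕ j)) ca

    d-At : (j : Fin k) → Definable₃ (λ f s a → At f s j a)
    d-At j {s = f} {s} {a} F S A = dmap
      (d∃ {A = λ γ p → p ≈ code j (a γ) × pair (s γ) p ε f γ} (d-code j v₀ (↑ A) d× d-pairε (↑ F) (↑ S) v₀))
      (λ γ h → mk⟺
        (λ (p , _ , e , m) → εˡ (pair-cong ≈-refl e) m)
        (λ m → code j (a γ) , con-code j (con-tm A {γ} h) , ≈-refl , m))

    module _ {f s : Env n → V} (F : Tm n f) (S : Tm n s) where

      d-Moves : ∀ {a} (j : Fin k) → Tm n a → Definable n (λ γ → Moves (At (f γ) (s γ)) j (a γ))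
      d-Moves j A = d∃∈ (! con-α) (d-At j (↑ F) (↑ S) v₀ d× d≈ (↑ A) v₀)

      d-Increments : ∀ {a} (j : Fin k) → Tm n a → Definable n (λ γ → Increments (At (f γ) (s γ)) j (a γ))
      d-Increments j A = d∃∈ (! con-α) (d-At j (↑ F) (↑ S) v₀ d× d-⁺ (↑ A) v₀)

      d-Asks : ∀ {a x} → Con x → (i : Fin k) → Tm n a → Definable n (λ γ → Asks x (At (f γ) (s γ)) i (a γ))
      d-Asks cx i A = d∃∈ (! con-α) (d-At (suc i) (↑ F) (↑ S) v₀ d×
        ((dε v₀ (! cx) d× d≈ (↑ A) (! (con-numeral 1))) d⊎
         (d¬ (dε v₀ (! cx)) d× d≈ (↑ A) (! (con-numeral 0)))))

    d-Jumps : {f s a : Env n → V} → Tm n f → Tm n s → (i j : Fin k) (l : ℕ) → Tm n a →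
              Definable n (λ γ → Jumps (At (f γ) (s γ)) i j l (a γ))
    d-Jumps {k = k} F S i j l A = d∃∈ (! con-α) (d-At (suc i) (↑ F) (↑ S) v₀ d×
      d∃∈ (! con-α) (d-At (suc j) (↑ (↑ F)) (↑ (↑ S)) v₀ d×
      ((d≈ (↑ v₀) v₀ d× d≈ (↑ (↑ A)) (! (con-numeral l))) d⊎
       (d¬ (d≈ (↑ v₀) v₀) d× d-Increments (↑ (↑ F)) (↑ (↑ S)) (zero {k}) (↑ (↑ A))))))

    d-Effect : {x : V} → Con x → {f s a : Env n → V} → Tm n f → Tm n s →
               (ι : Instruction k) (j : Fin (suc k)) → Tm n a →
               Definable n (λ γ → Effect ι x (At (f γ) (s γ)) j (a γ))
    d-Effect {k = k} cx F S (increment i)   zero    A = d-Increments F S (zero {k}) A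
    d-Effect cx F S (increment i)   (suc j) A = d-choose (j ≟ᶠ i) (d-Increments F S (suc i) A) (d-Moves F S (suc j) A)
    d-Effect {k = k} cx F S (copy i i′)     zero    A = d-Increments F S (zero {k}) A
    d-Effect cx F S (copy i i′)     (suc j) A = d-choose (j ≟ᶠ i′) (d-Moves F S (suc i) A) (d-Moves F S (suc j) A)
    d-Effect {k = k} cx F S (jumpIf≈ i j l) zero    A = d-Jumps F S i j l A
    d-Effect cx F S (jumpIf≈ _ _ _) (suc j) A = d-Moves F S (suc j) A
    d-Effect {k = k} cx F S (oracle i)      zero    A = d-Increments F S (zero {k}) A
    d-Effect cx F S (oracle i)      (suc j) A = d-choose (j ≟ᶠ i) (d-Asks F S cx i A) (d-Moves F S (suc j) A)

    Is : (Fin k → V) → Fin k → V → Set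
    Is f j b = b ≈ f j

    module _ {x : V} {c d : Configuration k} (bounded : ∀ j → component c j ε α) where

      private
        Old = Is (component c)

        moves⟺ : ∀ j {y a} → y ≈ component c j → Moves Old j a ⟺ a ≈ y
        moves⟺ j e = mk⟺ (λ (b , _ , p , q) → ≈-trans q (≈-trans p (≈-sym e)))
                       (λ q → _ , bounded j , ≈-refl , ≈-trans q e)

        increments⟺ : ∀ j {y a} → y ≈ component c j ⁺ → Increments Old j a ⟺ a ≈ y
        increments⟺ j {y} {a} e = mk⟺ (λ (b , _ , p , q) → ≈-trans {a} q (≈-trans {b ⁺} (⁺-cong p) (≈-sym e)))
                             (λ q → _ , bounded j , ≈-refl , ≈-trans {a} q e)

        line⟺ : ∀ {a} → line d ≡ suc (line c) → Increments Old zero a ⟺ a ≈ component d zero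
        line⟺ e = increments⟺ zero (≡⇒≈ (cong numeral e))

        update⟺ : ∀ {f i a} {New : Set₁} → (∀ {y} → y ≈ f (regs c i) → New ⟺ a ≈ y) →
                  regs d ≋ updateAt (regs c) i f → ∀ j →
                  choose (j ≟ᶠ i) New (Moves Old (suc j) a) ⟺ a ≈ regs d j
        update⟺ {f} {i} h e j with j ≟ᶠ i
        ... | yes refl = h (≈-trans (e i) (≡⇒≈ (updateAt-updates i (regs c))))
        ... | no j≢i   = moves⟺ (suc j) (≈-trans (e j) (≡⇒≈ (updateAt-minimal j i (regs c) j≢i)))

        asks⟺ : ∀ {i a} → (regs c i ∈ x → regs d ≋ updateAt (regs c) i (const (numeral 1))) →
                (¬ (regs c i ∈ x) → regs d ≋ updateAt (regs c) i (const (numeral 0))) →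
                ∀ j → choose (j ≟ᶠ i) (Asks x Old i a) (Moves Old (suc j) a) ⟺ a ≈ regs d j
        asks⟺ {i} {a} p q = [ inside , outside ]′ (decide em₀)
          where
          decide : Dec (regs c i ε x) → regs c i ε x ⊎ ¬ regs c i ε x
          decide (yes m) = inj₁ m
          decide (no n)  = inj₂ n
          inside : regs c i ε x → ∀ j → choose (j ≟ᶠ i) (Asks x Old i a) (Moves Old (suc j) a) ⟺ a ≈ regs d j
          inside m = update⟺ (λ e → mk⟺
            (λ { (b , _ , _ , inj₁ (_ , r)) → ≈-trans r (≈-sym e)
               ; (b , _ , r , inj₂ (n , _)) → ⊥-elim (n (εˡ (≈-sym r) m)) })
            (λ r → _ , bounded (suc i) , ≈-refl , inj₁ (m , ≈-trans r e))) (p (un m))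
          outside : ¬ regs c i ε x → ∀ j → choose (j ≟ᶠ i) (Asks x Old i a) (Moves Old (suc j) a) ⟺ a ≈ regs d j
          outside n = update⟺ (λ e → mk⟺
            (λ { (b , _ , r , inj₁ (m , _)) → ⊥-elim (n (εˡ r m))
               ; (b , _ , _ , inj₂ (_ , r)) → ≈-trans r (≈-sym e) })
            (λ r → _ , bounded (suc i) , ≈-refl , inj₂ (n , ≈-trans r e))) (q (n ∘ mk))

        jumps⟺ : ∀ {i j l} → (regs c i ≈ regs c j → line d ≡ l) →
                 (¬ (regs c i ≈ regs c j) → line d ≡ suc (line c)) →
                 ∀ a → Jumps Old i j l a ⟺ a ≈ component d zero
        jumps⟺ {i} {j} {l} p q a = go em₀
          where
          go : Dec (regs c i ≈ regs c j) → Jumps Old i j l a ⟺ a ≈ component d zero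
          go (yes e) = mk⟺
            (λ { (b , _ , _ , b′ , _ , _ , inj₁ (_ , r)) → ≈-trans r (≡⇒≈ (cong numeral (sym (p e))))
               ; (b , _ , r , b′ , _ , r′ , inj₂ (n , _)) → ⊥-elim (n (≈-trans r (≈-trans e (≈-sym r′)))) })
            (λ r → _ , bounded (suc i) , ≈-refl , _ , bounded (suc j) , ≈-refl ,
                   inj₁ (e , ≈-trans r (≡⇒≈ (cong numeral (p e)))))
          go (no n) = mk⟺
            (λ { (b , _ , r , b′ , _ , r′ , inj₁ (e , _)) → ⊥-elim (n (≈-trans (≈-sym r) (≈-trans e r′)))
               ; (b , _ , _ , b′ , _ , _ , inj₂ (_ , r)) → to (line⟺ (q n)) r })
            (λ r → _ , bounded (suc i) , ≈-refl , _ , bounded (suc j) , ≈-refl ,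
                   inj₂ (n , from (line⟺ (q n)) r))

      -- `Effect` is relational so that it can be read off a trace in L; applied to an actual
      -- configuration it pins down exactly the next one.
      execute⟺ : ∀ ι → Execute ι x c d → ∀ j a → Effect ι x Old j a ⟺ a ≈ component d j
      execute⟺ (increment i)   (l , r) zero    a = line⟺ l
      execute⟺ (increment i)   (l , r) (suc j) a = update⟺ (increments⟺ (suc i)) r j
      execute⟺ (copy i i′)     (l , r) zero    a = line⟺ l
      execute⟺ (copy i i′)     (l , r) (suc j) a = update⟺ (moves⟺ (suc i)) r j
      execute⟺ (jumpIf≈ i j l) (r , p , q) zero a = jumps⟺ p q a
      execute⟺ (jumpIf≈ _ _ _) (r , p , q) (suc j) a = moves⟺ (suc j) (r j)
      execute⟺ (oracle i)      (l , p , q) zero    a = line⟺ l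
      execute⟺ (oracle i)      (l , p , q) (suc j) a = asks⟺ p q j

    fetch : {A : Set} (xs : List A) (n : ℕ) {y : A} → head (drop n xs) ≡ just y →
            ∃[ l ] toℕ l ≡ n × lookupˡ xs l ≡ y
    fetch (x ∷ xs) zero    refl = zero , refl , refl
    fetch (x ∷ xs) (suc n) e    = let l , p , q = fetch xs n e in suc l , cong suc p , q
    fetch []       zero    ()
    fetch []       (suc n) ()

    start : V → Fin (suc (suc k)) → V
    start ξ zero    = ∅
    start ξ (suc j) = initialRegs ξ j

    -- The active line is found by a finite disjunction over the lines of the program, which can be
    -- written as a formula.
    Next : (P : Program) → V → (Fin (suc (Program.registers P)) → V → Set) →
           Fin (suc (Program.registers P)) → V → Set₁
    Next P x F j a = ∃[ l ] F zero (numeral (toℕ l)) × Effect (lookupˡ (Program.code P) l) x F j a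

    d-Next : ∀ P {x} → Con x → ∀ {n} {f s a : Env n → V} → Tm n f → Tm n s →
             ∀ j → Tm n a → Definable n (λ γ → Next P x (At (f γ) (s γ)) j (a γ))
    d-Next P cx F S j A = dFin∃ λ l →
      d-At (zero {Program.registers P}) F S (! (con-numeral (toℕ l))) d× d-Effect cx F S (lookupˡ (Program.code P) l) j A

    -- Runs and their traces in L

    module Run {P : Program} {x ξ : V} (C : HaltingComputation α P x ξ) where

      open HaltingComputation C
      open Program P using (registers; instructionAt) renaming (code to program)

      θ : V
      θ = haltingTime

      ord-θ : Ord θ
      ord-θ = fromOrdinal ordinal

      comp : V → Fin (suc registers) → V
      comp t = component (configuration t)

      comp-cong : ∀ {s t} → s ≈ t → ∀ j → comp s j ≈ comp t j
      comp-cong e zero    = ≡⇒≈ (cong numeral (line-cong _ _ e))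
      comp-cong e (suc j) = regs-cong _ _ e j

      comp-∅ : ∀ j → comp ∅ j ≈ start ξ j
      comp-∅ zero    = ≡⇒≈ (cong numeral start-line)
      comp-∅ (suc j) = start-regs j

      comp-α : ∀ {t} → t ε θ ⁺ → ∀ j → comp t j ε α
      comp-α m zero    = numeral-limit limit-α _
      comp-α m (suc j) = mk (bounded _ (un m) j)

      running : ∀ {t} → t ε θ → ∃[ ι ] instructionAt (line (configuration t)) ≡ just ι
      running m = let ι , e , _ = step _ (un m) in ι , e

      next⟺ : ∀ {s} → s ε θ → {F : Fin (suc registers) → V → Set} →
              (∀ j b → b ε α → F j b ⟺ b ≈ comp s j) →
              ∀ j a → Next P x F j a ⟺ a ≈ comp (s ⁺) j
      next⟺ {s} sθ {F} h j a = go (step s (un sθ))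
        where
        go : ∃[ ι ] instructionAt (line (configuration s)) ≡ just ι ×
                    Execute ι x (configuration s) (configuration (s ⁺)) →
             Next P x F j a ⟺ a ≈ comp (s ⁺) j
        go (ι , e , exec) = main (fetch program (line (configuration s)) e)
          where
          old⟺ : ∀ ι → Execute ι x (configuration s) (configuration (s ⁺)) →
                 Effect ι x F j a ⟺ a ≈ comp (s ⁺) j
          old⟺ ι exec = mk⟺
            (to (execute⟺ (comp-α (⁺-old sθ)) ι exec j a) ∘ effect-map (λ j b m → to (h j b m)) ι x j a)
            (effect-map (λ j b m → from (h j b m)) ι x j a ∘ from (execute⟺ (comp-α (⁺-old sθ)) ι exec j a))
          main : ∃[ l ] toℕ l ≡ line (configuration s) × lookupˡ program l ≡ ι →
                 Next P x F j a ⟺ a ≈ comp (s ⁺) j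
          main (l , l≡ , refl) = mk⟺
            (λ (l′ , p , q) → to (old⟺ _ exec) (subst (λ l → Effect (lookupˡ program l) x F j a)
              (toℕ-injective (trans (numeral-inj (to (h zero _ (numeral-limit limit-α _)) p)) (sym l≡))) q))
            (λ q → l , from (h zero _ (numeral-limit limit-α _)) (≡⇒≈ (cong numeral l≡)) , from (old⟺ _ exec) q)

      comp-limit : ∀ {t} → t ε θ ⁺ → Limit t → ∀ j z →
                   z ε comp t j ⟺ (∃[ s ] s ε t × (∀ r → r ε t → s ⊑ r → z ε comp r j))
      comp-limit {t} m l j z = mk⟺
        (λ p → let s , q , h = Equivalence.to (inf j) (un p) in s , mk q , λ r rt sr → mk (h r (un rt) (⊑⇒⊆ sr)))
        (λ (s , q , h) → mk (Equivalence.from (inf j) (s , un q , λ r rt sr → un (h r (mk rt) (⊆⇒⊑ sr)))))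
        where
        inf : ∀ j → z ∈ comp t j ⇔ (∃[ s ] s ∈ t × (∀ r → r ∈ t → s ⊆ r → z ∈ comp r j))
        inf zero    = limit-line t (un m) (toLimit l) z
        inf (suc j) = limit-regs t (un m) (toLimit l) j z

    module _ {P : Program} {x ξ : V} (C : HaltingComputation α P x ξ)
             {ξ′ : V} (C′ : HaltingComputation α P x ξ′) where

      private
        module R = Run C
        module R′ = Run C′

      -- Both next values satisfy the same relation `Next`, so the instructions need not be examined
      -- again. The times `s` and `s′` may differ, as the loop argument requires.
      same-step : ∀ {s s′} → s ε R.θ → s′ ε R′.θ → (∀ j → R.comp s j ≈ R′.comp s′ j) →
                  ∀ j → R.comp (s ⁺) j ≈ R′.comp (s′ ⁺) j
      same-step {s} {s′} m m′ e j = to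
        (R′.next⟺ m′ (λ j b _ → mk⟺ (λ p → ≈-trans p (e j)) (λ p → ≈-trans p (≈-sym (e j)))) j (R.comp (s ⁺) j))
        (from (R.next⟺ m {Is (R.comp s)} (λ j b _ → mk⟺ id id) j (R.comp (s ⁺) j)) ≈-refl)

    -- The halting time is not known to be in L at first. `D` is `α` for a run that is supposed to
    -- be long, and `θ ⁺` once `θ ε α` is known; both are in L because `α` is.
    module Trace {P : Program} {x ξ : V} (cx : Con x) (cξ : Con ξ) (C : HaltingComputation α P x ξ)
                 {D : V} (cD : Con D) (oD : Ord D) (D⊑θ⁺ : D ⊑ Run.θ C ⁺) where

      open Run C
      open Program P using (registers)

      Code : V → Set₁
      Code z = ∃[ j ] ∃[ a ] a ε α × z ≈ code {suc registers} j a

      d-Code : Definable₁ Code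
      d-Code Z = dFin∃ λ j → d∃∈ (! con-α) (d-code j (↑ Z) v₀)

      codes : ∃[ B ] Con B × (∀ z → z ε B ⟺ (Con z × Code z))
      codes = comprehension Code d-Code {Fin (suc registers) × index α} (λ (j , i) → code j (element α i))
        (λ (j , i) → con-code j (con-ε con-α (elem α i)))
        (λ { z _ (j , a , mk (i , e) , e′) → (j , i) , ≈-trans e′ (pair-cong ≈-refl e) })

      B : V
      B = proj₁ codes

      con-B : Con B
      con-B = proj₁ (proj₂ codes)

      code-B : ∀ {a} (j : Fin (suc registers)) → a ε α → code j a ε B
      code-B j m = from (proj₂ (proj₂ codes) _) (con-code j (con-ε con-α m) , j , _ , m , ≈-refl)

      History : V → V → Set
      History t z = ∃[ j ] z ≈ code j (comp t j)

      history⟺ : ∀ {t j a} → History t (code j a) ⟺ a ≈ comp t j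
      history⟺ {t} {j} {a} = mk⟺ (λ { (j′ , e) → go (code-inj e) }) (λ e → _ , pair-cong ≈-refl e)
        where
        go : ∀ {j′} → j ≡ j′ × a ≈ comp t j′ → a ≈ comp t j
        go (refl , e) = e

      con-start : ∀ j → Con (start {Program.extraRegisters P} ξ j)
      con-start zero          = con-∅
      con-start (suc zero)    = cξ
      con-start (suc (suc j)) = con-∅

      Successor : V → Set₁
      Successor t = ∃[ s ] s ε t × t ≈ s ⁺

      LimInf : V → V → Fin (suc registers) → V → Set₁
      LimInf f t j z = ∃[ s ] s ε t × (∀ r → r ε t → s ⊑ r → ∀ b → b ε α → At f r j b → z ε b)

      -- The cases are time zero, successor and limit, where a limit is expressed as neither of the
      -- others. In the limit case `a` is compared with the limit inferior elementwise; elements of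
      -- `α` suffice since all values are below `α`.
      Value : V → V → Fin (suc registers) → V → Set₁
      Value f t j a =
        (t ≈ ∅ × a ≈ start ξ j) ⊎
        (∃[ s ] s ε t × t ≈ s ⁺ × Next P x (At f s) j a) ⊎
        ((¬ t ≈ ∅ × ¬ Successor t) ×
         (∀ z → z ε α → (z ε a → LimInf f t j z) × (LimInf f t j z → z ε a)))

      Step : V → V → V → Set₁
      Step f t z = ∃[ j ] ∃[ a ] a ε α × z ≈ code j a × Value f t j a

      d-LimInf : ∀ j → Definable₃ (λ f t z → LimInf f t j z)
      d-LimInf j F T Z = d∃∈ T (d∀∈ (↑ T) (d-⊑ (↑ v₀) v₀ d→ d∀∈ (! con-α)
        (d-At j (↑ (↑ (↑ F))) (↑ v₀) v₀ d→ dε (↑ (↑ (↑ Z))) v₀)))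

      d-Value : ∀ j → Definable₃ (λ f t a → Value f t j a)
      d-Value j F T A =
        (d≈ T (! con-∅) d× d≈ A (! (con-start j))) d⊎
        d∃∈ T (d-⁺ (↑ T) v₀ d× d-Next P cx (↑ F) v₀ j (↑ A)) d⊎
        ((d¬ (d≈ T (! con-∅)) d× d¬ (d∃∈ T (d-⁺ (↑ T) v₀))) d×
         d∀∈ (! con-α) ((dε v₀ (↑ A) d→ d-LimInf j (↑ F) (↑ T) v₀) d× (d-LimInf j (↑ F) (↑ T) v₀ d→ dε v₀ (↑ A))))

      d-Step : Definable₃ Step
      d-Step F T Z = dFin∃ λ j → d∃∈ (! con-α) (d-code j (↑ Z) v₀ d× d-Value j (↑ F) (↑ T) v₀)

      module _ {t f : V} (tD : t ε D) (agrees : ∀ s → s ε t → ∀ z → z ε B → pair s z ε f ⟺ History s z) where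

        t-θ : t ε θ ⁺
        t-θ = tD ▹ D⊑θ⁺

        earlier : ∀ {s} → s ε t → s ε θ ⁺
        earlier m = trans₀ (ord-⁺ ord-θ) t-θ m

        at⟺ : ∀ {s} → s ε t → ∀ j b → b ε α → At f s j b ⟺ b ≈ comp s j
        at⟺ m j b bα = mk⟺ (to history⟺ ∘ to (agrees _ m _ (code-B j bα)))
                           (from (agrees _ m _ (code-B j bα)) ∘ from history⟺)

        at-successor : ∀ {s} → s ε t → t ≈ s ⁺ → ∀ j a → Next P x (At f s) j a ⟺ a ≈ comp t j
        at-successor {s} m e j a = mk⟺
          (λ p → ≈-trans (to (next⟺ sθ (at⟺ m) j a) p) (comp-cong (≈-sym e) j))
          (λ p → from (next⟺ sθ (at⟺ m) j a) (≈-trans p (comp-cong e j)))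
          where
          sθ : s ε θ
          sθ = [ (λ q → trans₀ ord-θ q m) , (λ e → εʳ e m) ]′ (⁺-elim t-θ)

        at-limit : Limit t → ∀ j z → LimInf f t j z ⟺ z ε comp t j
        at-limit l j z = mk⟺
          (λ (s , m , h) → from (comp-limit t-θ l j z)
            (s , m , λ r rt sr → h r rt sr _ (comp-α (earlier rt) j) (from (at⟺ rt j _ (comp-α (earlier rt) j)) ≈-refl)))
          (λ p → let s , m , h = to (comp-limit t-θ l j z) p in
            s , m , λ r rt sr b bα q → εʳ (≈-sym (to (at⟺ rt j b bα) q)) (h r rt sr))

        value⇒ : ∀ {j a} → a ε α → Value f t j a → a ≈ comp t j
        value⇒ {j} aα (inj₁ (e , p)) = ≈-trans p (≈-sym (≈-trans (comp-cong e j) (comp-∅ j)))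
        value⇒ {j} {a} aα (inj₂ (inj₁ (s , m , e , p))) = to (at-successor m e j a) p
        value⇒ {j} {a} aα (inj₂ (inj₂ ((n , n′) , h))) = go (ordinal-cases (ord-ε oD tD))
          where
          go : t ≈ ∅ ⊎ Successor t ⊎ Limit t → a ≈ comp t j
          go (inj₁ e)        = ⊥-elim (n e)
          go (inj₂ (inj₁ s)) = ⊥-elim (n′ s)
          go (inj₂ (inj₂ l)) = ext
            (λ z m → to (at-limit l j z) (proj₁ (h z (trans₀ ord-α aα m)) m))
            (λ z m → proj₂ (h z (trans₀ ord-α (comp-α t-θ j) m)) (from (at-limit l j z) m))

        value⇐ : ∀ {j a} → a ≈ comp t j → Value f t j a
        value⇐ {j} {a} p = go (ordinal-cases (ord-ε oD tD))
          where
          go : t ≈ ∅ ⊎ Successor t ⊎ Limit t → Value f t j a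
          go (inj₁ e) = inj₁ (e , ≈-trans p (≈-trans (comp-cong e j) (comp-∅ j)))
          go (inj₂ (inj₁ (s , m , e))) = inj₂ (inj₁ (s , m , e , from (at-successor m e j a) p))
          go (inj₂ (inj₂ l)) = inj₂ (inj₂ ((limit-≉∅ l , λ { (s , _ , e) → limit-≉⁺ l e }) , λ z _ →
            (λ m → from (at-limit l j z) (εʳ p m)) ,
            (λ q → εʳ (≈-sym p) (to (at-limit l j z) q))))

        step⟺ : ∀ z → z ε B → Step f t z ⟺ History t z
        step⟺ z zB = mk⟺
          (λ (j , a , aα , e , v) → j , ≈-trans e (pair-cong ≈-refl (value⇒ aα v)))
          (λ (j , e) → j , comp t j , comp-α t-θ j , e , value⇐ ≈-refl)

      module Rec = Recursion cD oD con-B History Step d-Step (λ t tD f cf agrees z zB → step⟺ tD agrees z zB)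

      -- What the trace is for: predicates handed to `collection` and `Recursion` may now mention
      -- the run, within `D` and `α`.
      d-comp : ∀ j → Definable₂ (λ t a → t ε D × a ε α × a ≈ comp t j)
      d-comp j T A = dmap
        (dε A (! con-α) d× d∃∈ (! con-B) (d-code j v₀ (↑ A) d× Rec.d-C (↑ T) v₀))
        (λ γ h → mk⟺
          (λ { (aα , z , zB , e , tD , _ , j′ , e′) → tD , aα , to history⟺ (j′ , ≈-trans (≈-sym e) e′) })
          (λ (tD , aα , p) → aα , _ , code-B j aα , ≈-refl , tD , code-B j aα , from history⟺ p))

    -- Loops

    finite-bound : {Q : Fin m → V → Set₁} → (∀ j s s′ → s ⊑ s′ → Q j s → Q j s′) →
                   (∀ j → ∃[ s ] s ε α × Q j s) → ∃[ s ] s ε α × (∀ j → Q j s)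
    finite-bound {zero}  up h = ∅ , has-∅ limit-α , λ ()
    finite-bound {suc m} {Q} up h = go (h zero) (finite-bound (up ∘ suc) (h ∘ suc))
      where
      go : ∃[ s ] s ε α × Q zero s → ∃[ s ] s ε α × (∀ j → Q (suc j) s) → ∃[ s ] s ε α × (∀ j → Q j s)
      go (s , sα , q) (s′ , sα′ , q′) =
        [ (λ m → s′ , sα′ , λ { zero → up zero s s′ (ord-⊑ (ord-ε ord-α sα′) m) q ; (suc j) → q′ j })
        , (λ i → s , sα , λ { zero → q ; (suc j) → up (suc j) s′ s i (q′ j) })
        ]′ (ord-split (ord-ε ord-α sα) (ord-ε ord-α sα′))

    ⊔-exists : Ord a → b ε a → c ε a → ∃[ d ] d ε a × b ⊑ d × c ⊑ d
    ⊔-exists {b = b} {c} o p q =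
      [ (λ m → c , q , ord-⊑ (ord-ε o q) m , ⊑-refl) , (λ i → b , p , ⊑-refl , i) ]′
      (ord-split (ord-ε o p) (ord-ε o q))

    -- A time below `α` with the configuration of time `α`

    module Repetition {P : Program} {x ξ : V} (cx : Con x) (cξ : Con ξ) (C : HaltingComputation α P x ξ)
                      (α⊑θ : α ⊑ Run.θ C) where

      open Run C public
      open Program P using (registers)

      Component : Set
      Component = Fin (suc registers)

      below-α : ∀ {t} → t ε α → t ε θ ⁺
      below-α m = ⁺-old (m ▹ α⊑θ)

      α-θ⁺ : α ε θ ⁺
      α-θ⁺ = [ ⁺-old , (λ e → εˡ (≈-sym e) ⁺-new) ]′ (⊑-split ord-α ord-θ α⊑θ)

      ρ : Component → V
      ρ = comp α

      ρ-α : ∀ j → ρ j ε α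
      ρ-α = comp-α α-θ⁺

      module Tr = Trace cx cξ C con-α ord-α (⊑-trans α⊑θ x⊑x⁺)

      -- Each element of `ρ j` is eventually in component `j`. As `ρ j ε α` by the absence of
      -- overflow at time `α`, collection along `ρ j` makes the threshold uniform.
      eventually-in : ∀ j → ∃[ s ] s ε α × (∀ r → r ε α → s ⊑ r → ρ j ⊑ comp r j)
      eventually-in j = go (collection (ρ-α j) In d-In total)
        where
        In : V → V → Set₁
        -- `comp r j` is not a term of the language, so its value is named by `b` through `d-comp`.
        In z s = ∀ r → r ε α → s ⊑ r → ∀ b → b ε α → r ε α × b ε α × b ≈ comp r j → z ε b
        d-In : Definable₂ In
        d-In Z S = d∀∈ (! con-α) (d-⊑ (↑ S) v₀ d→ d∀∈ (! con-α) (Tr.d-comp j (↑ v₀) v₀ d→ dε (↑ (↑ Z)) v₀))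
        total : ∀ z → z ε ρ j → ∃[ s ] s ε α × In z s
        total z m = let s , sα , h = to (comp-limit α-θ⁺ limit-α j z) m in
          s , sα , λ r rα sr b _ (_ , _ , e) → εʳ (≈-sym e) (h r rα sr)
        go : ∃[ g ] g ε α × (∀ z → z ε ρ j → ∃[ s ] s ε g × In z s) →
             ∃[ s ] s ε α × (∀ r → r ε α → s ⊑ r → ρ j ⊑ comp r j)
        go (g , gα , h) = g , gα , λ r rα gr → ⊑-intro λ z m →
          let s , sg , i = h z m in
          i r rα (⊑-trans (ord-⊑ (ord-ε ord-α gα) sg) gr) (comp r j) (comp-α (below-α rα) j)
            (rα , comp-α (below-α rα) j , ≈-refl)

      settled : ∃[ s ] s ε α × (∀ j r → r ε α → s ⊑ r → ρ j ⊑ comp r j)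
      settled = finite-bound (λ j s s′ i h r rα sr → h r rα (⊑-trans i sr)) eventually-in

      s₀ : V
      s₀ = proj₁ settled

      s₀-α : s₀ ε α
      s₀-α = proj₁ (proj₂ settled)

      above-s₀ : ∀ {r} j → r ε α → s₀ ⊑ r → ρ j ⊑ comp r j
      above-s₀ {r} j = proj₂ (proj₂ settled) j r

      -- If component `j` stayed strictly above `ρ j` from some time on, then `ρ j` would be an
      -- element of the limit inferior, which is `ρ j` itself.
      recurs : ∀ j s → s ε α → ∃[ r ] r ε α × s ⊑ r × comp r j ≈ ρ j
      recurs j s sα = ¬¬-elim λ n → go n (⊔-exists ord-α sα s₀-α)
        where
        go : ¬ (∃[ r ] r ε α × s ⊑ r × comp r j ≈ ρ j) → ∃[ d ] d ε α × s ⊑ d × s₀ ⊑ d → ⊥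
        go n (d , dα , sd , s₀d) = ε-irrefl (ρ j) (from (comp-limit α-θ⁺ limit-α j (ρ j)) (d , dα , λ r rα dr →
          [ id , (λ e → ⊥-elim (n (r , rα , ⊑-trans sd dr , ≈-sym e))) ]′
          (⊑-split (ord-ε ord-α (ρ-α j)) (ord-ε ord-α (comp-α (below-α rα) j)) (above-s₀ j rα (⊑-trans s₀d dr)))))

      -- bound t is the least z ≥ s₀ such that every ρ j recurs between
      -- bound s and z, for all s < t.
      Hit₀ : {I : Set} → (I → V) → V → Set
      Hit₀ {I} e z = s₀ ⊑ z × (∀ (i : I) (j : Component) →
        Σ[ r ∈ index α ] element α r ε z × e i ⊑ element α r × comp (element α r) j ≈ ρ j)

      -- Hits are upwards closed, so the set of non-hits below `α` is the least hit, and it is `α`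
      -- if there is none. `Hit₀` is small, so `sep` applies at each step of the structural
      -- recursion.
      bound : V → V
      bound (sup I f) = sep α λ z → ¬ Hit₀ (λ i → bound (f i)) z

      hit₀-resp : ∀ {I} (e : I → V) {y z} → y ≈ z → Hit₀ e y → Hit₀ e z
      hit₀-resp f p (s , h) = ⊑-trans s (≈⇒⊑ p) , λ i j → let r , rz , b , v = h i j in r , εʳ p rz , b , v

      bound₀ : ∀ {I} {f : I → V} {z} → z ε bound (sup I f) ⟺ (z ε α × ¬ Hit₀ (λ i → bound (f i)) z)
      bound₀ {f = f} = mk⟺
        (λ m → let zα , y , e , n = sep-elim m in zα , n ∘ hit₀-resp (λ i → bound (f i)) e)
        (λ (zα , n) → sep-intro (λ e n h → n (hit₀-resp (λ i → bound (f i)) (≈-sym e) h)) zα n)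

      bound-half : ∀ {I J} (f : I → V) (g : J → V) → (∀ i → ∃[ j ] bound (f i) ≈ bound (g j)) →
                   bound (sup I f) ⊑ bound (sup J g)
      bound-half f g h = ⊑-intro λ z m → let zα , n = to (bound₀ {f = f}) m in
        from (bound₀ {f = g}) (zα , λ (s , k) → n (s , λ i j →
          let i′ , e = h i; r , rz , b , v = k i′ j in r , rz , ⊑-trans (≈⇒⊑ e) b , v))

      bound-cong : ∀ {t t′} → t ≈ t′ → bound t ≈ bound t′
      bound-cong {sup I f} {sup J g} (p , q) = ⊑-antisym
        (bound-half f g λ i → let j , e = p i in j , bound-cong e)
        (bound-half g f λ j → let i , e = q j in i , ≈-sym (bound-cong e))

      bound-mono : ∀ {t t′} → t ⊑ t′ → bound t ⊑ bound t′
      bound-mono {sup I f} {sup J g} s =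
        bound-half f g λ i → let j , e = un (incl s i) in j , bound-cong e

      Hit : V → V → Set₁
      Hit t z = s₀ ⊑ z × (∀ s → s ε t → ∀ j → ∃[ r ] r ε z × bound s ⊑ r × comp r j ≈ ρ j)

      bound⟺ : ∀ t {z} → z ε bound t ⟺ (z ε α × ¬ Hit t z)
      bound⟺ (sup I f) {z} = mk⟺
        (λ m → let zα , n = to (bound₀ {f = f}) m in zα , λ (p , h) → n (p , λ i j → small zα j (h (f i) (elem (sup I f) i) j)))
        (λ (zα , n) → from (bound₀ {f = f}) (zα , λ (p , h) → n (p , λ s m j → large (un m) j h)))
        where
        small : ∀ {y} → z ε α → ∀ j → ∃[ r ] r ε z × y ⊑ r × comp r j ≈ ρ j →
                Σ[ r ∈ index α ] element α r ε z × y ⊑ element α r × comp (element α r) j ≈ ρ j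
        small {y} zα j (r , rz , b , v) = go (un (trans₀ ord-α zα rz))
          where
          go : r ∈ α → Σ[ r ∈ index α ] element α r ε z × y ⊑ element α r × comp (element α r) j ≈ ρ j
          go (k , e) = k , εˡ e rz , ⊑-trans b (≈⇒⊑ e) , ≈-trans (comp-cong (≈-sym e) j) v
        large : ∀ {s} → s ∈ sup I f → ∀ j →
                (∀ (i : I) (j : Component) → Σ[ r ∈ index α ] element α r ε z × bound (f i) ⊑ element α r × comp (element α r) j ≈ ρ j) →
                ∃[ r ] r ε z × bound s ⊑ r × comp r j ≈ ρ j
        large (i , e) j h = let r , rz , b , v = h i j in element α r , rz , ⊑-trans (≈⇒⊑ (bound-cong e)) b , v

      hit-up : ∀ t {y z} → y ⊑ z → Hit t y → Hit t z
      hit-up t i (p , h) = ⊑-trans p i , λ s m j → let r , ry , b , v = h s m j in r , ry ▹ i , b , v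

      bound-⊑α : ∀ t → bound t ⊑ α
      bound-⊑α t = ⊑-intro λ z m → proj₁ (to (bound⟺ t) m)

      bound-least : ∀ t {z} → z ε α → Hit t z → bound t ⊑ z
      bound-least t zα h = ⊑-intro λ y m → let yα , n = to (bound⟺ t) m in
        [ id , (λ i → ⊥-elim (n (hit-up t i h))) ]′ (ord-split (ord-ε ord-α yα) (ord-ε ord-α zα))

      ord-bound : ∀ t → Ord (bound t)
      ord-bound t = record
        { trans₀ = λ m n → let yα , h = to (bound⟺ t) m in
            from (bound⟺ t) (trans₀ ord-α yα n , h ∘ hit-up t (ord-⊑ (ord-ε ord-α yα) n))
        ; trans₁ = λ m → trans₁ ord-α (m ▹ bound-⊑α t) }

      hit⇒bound-α : ∀ t {z} → z ε α → Hit t z → bound t ε α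
      hit⇒bound-α t zα h = ⊑-ε (ord-ε ord-α zα) ord-α (bound-least t zα h) zα (ord-bound t)

      -- A bound below `α` that is no hit would be one of its own elements.
      bound-hit : ∀ t → bound t ε α → Hit t (bound t)
      bound-hit t m = ¬¬-elim λ n → ε-irrefl (bound t) (from (bound⟺ t) (m , n))

      -- The bounds of all `s ε t ⁺` are at most `bound t`, so a single recurrence beyond `bound t`
      -- per component is enough.
      next-hit : ∀ {t} → Ord t → bound t ε α → ∃[ z ] z ε α × Hit (t ⁺) z
      next-hit {t} o m = let z , zα , h = finite-bound up hits in
        z , zα , proj₁ (h zero) , λ s sε j → let r , rz , b , v = proj₂ (h j) in
          r , rz , ⊑-trans (earlier (⁺-elim sε)) b , v
        where
        Q : Component → V → Set₁
        Q j z = s₀ ⊑ z × (∃[ r ] r ε z × bound t ⊑ r × comp r j ≈ ρ j)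
        up : ∀ j s s′ → s ⊑ s′ → Q j s → Q j s′
        up j s s′ i (p , r , rz , b , v) = ⊑-trans p i , r , rz ▹ i , b , v
        hits : ∀ j → ∃[ z ] z ε α × Q j z
        hits j = let d , dα , p , q = ⊔-exists ord-α m s₀-α
                     r , rα , dr , v = recurs j d dα
                 -- The successor, because a hit must contain the recurrence time as an element.
                 in r ⁺ , has-⁺ limit-α rα , ⊑-trans q (⊑-trans dr (x⊑x⁺ {r})) , r , ⁺-new , ⊑-trans p dr , v
        earlier : ∀ {s} → s ε t ⊎ s ≈ t → bound s ⊑ bound t
        earlier (inj₁ sε) = bound-mono (ord-⊑ o sε)
        earlier (inj₂ e)  = ≈⇒⊑ (bound-cong e)

      bound-numeral : ∀ n → bound (numeral n) ε α
      bound-numeral zero    = hit⇒bound-α ∅ s₀-α (⊑-refl , λ s m → ⊥-elim (∅-empty m))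
      bound-numeral (suc n) = let z , zα , h = next-hit (ord-numeral n) (bound-numeral n) in
        hit⇒bound-α (numeral (suc n)) zα h

      bound-ω : ∀ {t} → t ε ω → bound t ε α
      bound-ω m = let n , e = ω-elim m in εˡ (≈-sym (bound-cong e)) (bound-numeral n)

      con-ω : Con ω
      con-ω = con-ε con-α ω-ε-α

      Above : V → V → V → Set₁
      Above f s r = ∀ y → y ε α → pair s y ε f → y ε r

      Recurs : V → V → Component → V → Set₁
      Recurs f s j z = ∃[ r ] r ε z × Above f s r × (r ε α × ρ j ε α × ρ j ≈ comp r j)

      -- The negation of `Hit`, with the earlier bounds read off the set `f`; `Above f s r` stands
      -- for `bound s ⊑ r`.
      Miss : V → V → V → Set₁
      Miss f t z = ¬ (s₀ ⊑ z × (∀ s → s ε t → ∀ j → Recurs f s j z))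

      d-Miss : Definable₃ Miss
      d-Miss F T Z = d¬ (d-⊑ (! (con-ε con-α s₀-α)) Z d× d∀∈ T (dFin∀ λ j → d∃∈ (↑ Z)
        (d∀∈ (! con-α) (d-pairε (↑ (↑ (↑ F))) (↑ (↑ v₀)) v₀ d→ dε v₀ (↑ v₀)) d×
         Tr.d-comp j v₀ (! (con-ε con-α (ρ-α j))))))

      miss⟺ : ∀ t → t ε ω → ∀ f → (∀ s → s ε t → ∀ z → z ε α → pair s z ε f ⟺ z ε bound s) →
              ∀ z → z ε α → Miss f t z ⟺ z ε bound t
      miss⟺ t tω f agrees z zα = mk⟺
        (λ n → from (bound⟺ t) (zα , λ (p , h) → n (p , λ s m j → let r , rz , b , v = h s m j in
          r , rz , (λ y yα q → to (agrees s m y yα) q ▹ b) , trans₀ ord-α zα rz , ρ-α j , ≈-sym v)))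
        (λ m (p , h) → proj₂ (to (bound⟺ t) m) (p , λ s m j → let r , rz , b , _ , _ , v = h s m j in
          r , rz , ⊑-intro (λ y k → let yα = k ▹ bound-⊑α s in b y yα (from (agrees s m y yα) k)) , ≈-sym v))

      module Rec = Recursion con-ω (isOrd limit-ω) con-α (λ t z → z ε bound t) Miss d-Miss
                             (λ t tω f _ → miss⟺ t tω f)

      T : V
      T = ⋃ᵢ λ n → bound (numeral n)

      bound-⊑T : ∀ n → bound (numeral n) ⊑ T
      bound-⊑T n = ⊑-intro λ z → ⋃-intro (λ n → bound (numeral n)) n

      T-elim : z ε T → ∃[ n ] z ε bound (numeral n)
      T-elim = ⋃-elim λ n → bound (numeral n)

      -- Here uncountability enters: `ω ε α`, and the sequence of bounds is definable in L, so
      -- collection keeps it below some `g ε α`.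
      T-bounded : ∃[ g ] g ε α × (∀ t → t ε ω → ∃[ u ] u ε g × (∀ z → z ε α → (t ε ω × z ε α × z ε bound t) → z ε u))
      T-bounded = collection ω-ε-α (λ t u → ∀ z → z ε α → (t ε ω × z ε α × z ε bound t) → z ε u)
        (λ T U → d∀∈ (! con-α) (Rec.d-C (↑ T) v₀ d→ dε v₀ (↑ U)))
        (λ t m → bound t , bound-ω m , λ z _ (_ , _ , p) → p)

      ord-T : Ord T
      ord-T = ord-⋃ {g = λ n → bound (numeral n)} λ n → ord-bound (numeral n)

      T-α : T ε α
      T-α = go T-bounded
        where
        go : ∃[ g ] g ε α × (∀ t → t ε ω → ∃[ u ] u ε g × (∀ z → z ε α → (t ε ω × z ε α × z ε bound t) → z ε u)) → T ε α
        go (g , gα , h) = ⊑-ε (ord-ε ord-α gα) ord-α (⊑-intro λ z m →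
          let n , k = T-elim m
              nω = mk (n , ≈-refl)
              u , ug , i = h (numeral n) nω
              zα = k ▹ bound-⊑α (numeral n)
          in trans₀ (ord-ε ord-α gα) ug (i z zα (nω , zα , k))) gα ord-T

      -- A hit for the next numeral has an element `r` with `bound (numeral n) ⊑ r`; were
      -- `bound (numeral n)` such a hit, `r ε r` would follow. Any component serves to produce `r`.
      bound-increasing : ∀ n → bound (numeral n) ε bound (numeral (suc n))
      bound-increasing n = from (bound⟺ (numeral (suc n))) (bound-numeral n , λ (_ , h) →
        let r , rb , b , _ = h (numeral n) (⁺-new {numeral n}) zero in ε-irrefl r (rb ▹ b))

      bound-T : ∀ n → bound (numeral n) ε T
      bound-T n = bound-increasing n ▹ bound-⊑T (suc n)

      limit-T : Limit T
      limit-T = record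
        { isOrd = ord-T
        ; has-∅ = ∅-least ord-T (bound-T 0)
        ; has-⁺ = λ {y} m → let n , k = T-elim m in
            ⊑-ε (ord-bound (numeral n)) ord-T (⁺-⊑ (ord-bound (numeral n)) k) (bound-T n) (ord-⁺ (ord-ε ord-T m)) }

      s₀⊑bound : ∀ n → s₀ ⊑ bound (numeral n)
      s₀⊑bound n = proj₁ (bound-hit (numeral n) (bound-numeral n))

      s₀⊑T : s₀ ⊑ T
      s₀⊑T = ⊑-trans (s₀⊑bound 0) (bound-⊑T 0)

      -- Recurrences of `ρ j` are cofinal in `T`, so the limit inferior is at most `ρ j`; beyond
      -- `s₀` no value is smaller, so it is at least `ρ j`.
      comp-T : ∀ j → comp T j ≈ ρ j
      comp-T j = ext
        (λ z m → let s , sT , h = to (comp-limit (below-α T-α) limit-T j z) m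
                     n , sn = T-elim sT
                     r , rb , b , v = proj₂ (bound-hit (numeral (suc n)) (bound-numeral (suc n))) (numeral n) (⁺-new {numeral n}) j
                 in εʳ v (h r (rb ▹ bound-⊑T (suc n)) (⊑-trans (ord-⊑ (ord-bound (numeral n)) sn) b)))
        (λ z m → from (comp-limit (below-α T-α) limit-T j z) (bound (numeral 0) , bound-T 0 , λ r rT b →
          m ▹ above-s₀ j (trans₀ ord-α T-α rT) (⊑-trans (s₀⊑bound 0) b)))

      above-T : ∀ {r} j → r ε α → T ⊑ r → ρ j ⊑ comp r j
      above-T j rα i = above-s₀ j rα (⊑-trans s₀⊑T i)

    -- The loop from time `T` on

    just≢nothing : {A : Set} {m : Maybe A} {a : A} → m ≡ just a → m ≢ nothing
    just≢nothing refl ()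

    -- u + (t - T), for t ≥ T
    module Shift (T : V) (oT : Ord T) (u : V) (ou : Ord u) where

      -- Elements of `t` below `T` contribute nothing, so any `t` up to `T` is sent to `u`.
      shift : V → V
      shift (sup I f) = u ∪ ⋃ᵢ λ ((i , _) : Σ[ i ∈ I ] T ⊑ f i) → shift (f i) ⁺

      private
        tail : {I : Set} (f : I → V) → (Σ[ i ∈ I ] T ⊑ f i) → V
        tail f (i , _) = shift (f i) ⁺

      u⊑shift : ∀ t → u ⊑ shift t
      u⊑shift (sup I f) = ⊑-∪ˡ {u} {⋃ᵢ (tail f)}

      shift-⊑ : ∀ {I} (f : I → V) {w} → u ⊑ w → (∀ i → T ⊑ f i → shift (f i) ⁺ ⊑ w) → shift (sup I f) ⊑ w
      shift-⊑ {I} f {w} uw h = ⊑-intro λ z m → [ _▹ uw , (λ k → go z (⋃-elim (tail f) k)) ]′ (∪-elim {z} {u} {⋃ᵢ (tail f)} m)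
        where
        go : ∀ z → ∃[ i ] z ε tail f i → z ε w
        go z ((i , p) , k) = k ▹ h i p

      shift⁺-⊑ : ∀ {I} (f : I → V) i → T ⊑ f i → shift (f i) ⁺ ⊑ shift (sup I f)
      shift⁺-⊑ f i p = ⊑-trans (⊑-intro λ z → ⋃-intro (tail f) (i , p)) (⊑-∪ʳ {⋃ᵢ (tail f)} {u})

      shift-cong : ∀ {t t′} → t ≈ t′ → shift t ≈ shift t′
      shift-cong {sup I f} {sup J g} (p , q) = ⊑-antisym
        (shift-⊑ f (u⊑shift (sup J g)) λ i T⊑ → let j , e = p i in
          ⊑-trans (≈⇒⊑ (⁺-cong {shift (f i)} {shift (g j)} (shift-cong e))) (shift⁺-⊑ g j (⊑-trans T⊑ (≈⇒⊑ e))))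
        (shift-⊑ g (u⊑shift (sup I f)) λ j T⊑ → let i , e = q j in
          ⊑-trans (≈⇒⊑ (⁺-cong {shift (g j)} {shift (f i)} (≈-sym (shift-cong e)))) (shift⁺-⊑ f i (⊑-trans T⊑ (≈⇒⊑ (≈-sym e)))))

      shift-step : ∀ {s} t → s ε t → T ⊑ s → shift s ε shift t
      shift-step {s} (sup I f) (mk (i , e)) p =
        εˡ (≈-sym (shift-cong e)) (⁺-new {shift (f i)} ▹ shift⁺-⊑ f i (⊑-trans p (≈⇒⊑ e)))

      shift-cases : ∀ {z} t → z ε shift t → z ε u ⊎ (∃[ s ] s ε t × T ⊑ s × z ε shift s ⁺)
      shift-cases {z} (sup I f) m = [ inj₁ , (λ k → inj₂ (go (⋃-elim (tail f) k))) ]′ (∪-elim {z} {u} {⋃ᵢ (tail f)} m)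
        where
        go : ∃[ i ] z ε tail f i → ∃[ s ] s ε sup I f × T ⊑ s × z ε shift s ⁺
        go ((i , p) , k) = f i , elem (sup I f) i , p , k

      ord-shift : ∀ t → Ord (shift t)
      ord-shift (sup I f) = ord-∪ ou (ord-⋃ {g = tail f} λ (i , _) → ord-⁺ (ord-shift (f i)))

      shift-elim : ∀ t → Ord t → ∀ {z} → z ε shift t → u ⊑ z → ∃[ s ] s ε t × T ⊑ s × z ≈ shift s
      shift-elim = ε-induction _ λ t ih o {z} m uz →
        [ (λ k → ⊥-elim (ε-irrefl z (k ▹ uz))) , (λ (s , sε , p , k) → go t o s sε p (ih s sε (ord-ε o sε)) uz (⁺-elim {z} {shift s} k)) ]′
        (shift-cases t m)
        where
        go : ∀ t → Ord t → ∀ {z} s → s ε t → T ⊑ s →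
             (∀ {z} → z ε shift s → u ⊑ z → ∃[ r ] r ε s × T ⊑ r × z ≈ shift r) →
             u ⊑ z → z ε shift s ⊎ z ≈ shift s → ∃[ r ] r ε t × T ⊑ r × z ≈ shift r
        go t o s sε p ih uz (inj₁ k) = let r , rε , q , e = ih k uz in r , trans₀ o sε rε , q , e
        go t o s sε p ih uz (inj₂ e) = s , sε , p , e

      shift-T : shift T ≈ u
      shift-T = ⊑-antisym (⊑-intro λ z m →
        [ id , (λ (s , sT , p , _) → ⊥-elim (ε⇒⋢ sT p)) ]′ (shift-cases T m)) (u⊑shift T)

      shift-⁺ : ∀ {s} → Ord s → T ⊑ s → shift (s ⁺) ≈ shift s ⁺
      shift-⁺ {s} o p = ⊑-antisym
        (⊑-intro λ z m → [ (λ k → ⁺-old {z} {shift s} (k ▹ u⊑shift s)) , (λ (r , rε , q , k) → go r q k (⁺-elim {r} {s} rε)) ]′ (shift-cases (s ⁺) m))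
        (⁺-⊑ (ord-shift (s ⁺)) (shift-step (s ⁺) (⁺-new {s}) p))
        where
        go : ∀ r {z} → T ⊑ r → z ε shift r ⁺ → r ε s ⊎ r ≈ s → z ε shift s ⁺
        go r q k (inj₁ rs) = ⁺-old {x = shift s} (k ▹ ⁺-⊑ (ord-shift s) (shift-step s rs q))
        go r q k (inj₂ e)  = εʳ {shift r ⁺} {shift s ⁺} (⁺-cong {shift r} {shift s} (shift-cong e)) k

      -- `T ε t` has to be strict: at `T` the value is `u`, which may be a successor.
      limit-shift : ∀ {t} → Limit t → T ε t → Limit (shift t)
      limit-shift {t} l Tt = record
        { isOrd = ord-shift t
        ; has-∅ = ∅-least (ord-shift t) (shift-step t Tt ⊑-refl)
        ; has-⁺ = λ {z} m → [ below-u z , (λ (s , sε , p , k) → go s sε p (⁺-elim {z} {shift s} k)) ]′ (shift-cases t m) }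
        where
        bump : ∀ {s} → s ε t → T ⊑ s → shift s ⁺ ε shift t
        bump {s} sε p = εˡ (shift-⁺ (ord-ε (isOrd l) sε) p)
          (shift-step t (has-⁺ l sε) (⊑-trans p (x⊑x⁺ {s})))
        below-u : ∀ z → z ε u → z ⁺ ε shift t
        below-u z m = ⊑-ε (ord-shift T) (ord-shift t) (⊑-trans (⁺-⊑ ou m) (u⊑shift T)) (shift-step t Tt ⊑-refl) (ord-⁺ (ord-ε ou m))
        go : ∀ {z} s → s ε t → T ⊑ s → z ε shift s ⊎ z ≈ shift s → z ⁺ ε shift t
        go {z} s sε p (inj₁ k) = ⊑-ε (ord-shift s) (ord-shift t) (⁺-⊑ (ord-shift s) k) (shift-step t sε p) (ord-⁺ (ord-ε (ord-shift s) k))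
        go {z} s sε p (inj₂ e) = εˡ {shift s ⁺} {z ⁺} (⁺-cong {shift s} {z} (≈-sym e)) (bump sε p)

    module Loop {P : Program} {x ξ : V} (cx : Con x) (cξ : Con ξ) (C : HaltingComputation α P x ξ)
                (α⊑θ : α ⊑ Run.θ C) where

      open Repetition cx cξ C α⊑θ

      T⊑α : T ⊑ α
      T⊑α = ord-⊑ ord-α T-α

      T⊑⇒α : ∀ {s t} → t ε α ⁺ → s ε t → s ε α
      T⊑⇒α tα m = [ (λ k → trans₀ ord-α k m) , (λ e → εʳ e m) ]′ (⁺-elim tα)

      module _ {u : V} (uθ : u ε θ ⁺) (cu : ∀ j → comp u j ≈ ρ j) where

        ou : Ord u
        ou = ord-ε (ord-⁺ ord-θ) uθ

        open Shift T ord-T u ou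

        -- From `u` on, the run copies what it did from `T` on. The range includes `t = α`, where
        -- the copy arrives at `ρ` again and the next period can begin.
        repeats : ∀ t → t ε α ⁺ → T ⊑ t → shift t ε θ ⁺ → ∀ j → comp (shift t) j ≈ comp t j
        repeats = ε-induction _ λ t ih tα Tt m →
          [ (λ k → go t ih tα k m (ordinal-cases (ord-ε (ord-⁺ ord-α) tα)))
          , (λ e j → ≈-trans (comp-cong (≈-trans (shift-cong (≈-sym e)) shift-T) j)
                     (≈-trans (cu j) (≈-trans (≈-sym (comp-T j)) (comp-cong e j)))) ]′
          (⊑-split ord-T (ord-ε (ord-⁺ ord-α) tα) Tt)
          where
          go : ∀ t → (∀ s → s ε t → s ε α ⁺ → T ⊑ s → shift s ε θ ⁺ → ∀ j → comp (shift s) j ≈ comp s j) →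
               t ε α ⁺ → T ε t → shift t ε θ ⁺ → t ≈ ∅ ⊎ (∃[ s ] s ε t × t ≈ s ⁺) ⊎ Limit t →
               ∀ j → comp (shift t) j ≈ comp t j
          go t ih tα Tt m (inj₁ e) j = ⊥-elim (∅-empty (εʳ e Tt))
          go t ih tα Tt m (inj₂ (inj₁ (s , sε , e))) j =
            ≈-trans (comp-cong e′ j)
              (≈-trans (same-step C C {shift s} {s} m″ (sα ▹ α⊑θ) (ih s sε (⁺-old sα) Ts (⁺-old m″)) j)
                       (comp-cong (≈-sym e) j))
            where
            sα : s ε α
            sα = T⊑⇒α tα sε
            Ts : T ⊑ s
            Ts = [ ord-⊑ (ord-ε ord-α sα) , ≈⇒⊑ ]′ (⁺-elim {T} {s} (εʳ e Tt))
            e′ : shift t ≈ shift s ⁺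
            e′ = ≈-trans (shift-cong e) (shift-⁺ (ord-ε ord-α sα) Ts)
            m″ : shift s ε θ
            m″ = [ (λ k → trans₀ ord-θ k (εʳ (≈-sym e′) (⁺-new {shift s})))
                 , (λ k → εʳ k (εʳ (≈-sym e′) (⁺-new {shift s}))) ]′ (⁺-elim m)
          -- Both limits inferior run over the same values: `fwd` turns a tail of `shift t` into a
          -- tail of `t`, and `bwd` pulls the times after `shift d` back by `shift-elim`.
          go t ih tα Tt m (inj₂ (inj₂ l)) j = ext
            (λ z k → let s , sε , h = to (comp-limit m (limit-shift l Tt) j z) k in
              from (comp-limit tθ l j z) (fwd z s sε h (shift-cases t sε)))
            (λ z k → let s , sε , h = to (comp-limit tθ l j z) k
                         d , dt , sd , Td = ⊔-exists (isOrd l) sε Tt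
                     in from (comp-limit m (limit-shift l Tt) j z)
                       (shift d , shift-step t dt Td , λ r rε i →
                         bwd z s h d sd dt i (shift-elim t (isOrd l) rε (⊑-trans (u⊑shift d) i))))
            where
            tθ : t ε θ ⁺
            tθ = [ below-α , (λ e → εˡ (≈-sym e) α-θ⁺) ]′ (⁺-elim tα)
            same : ∀ {r} → r ε t → T ⊑ r → comp (shift r) j ≈ comp r j
            same rt Tr = ih _ rt (⁺-old (T⊑⇒α tα rt)) Tr (trans₀ (ord-⁺ ord-θ) m (shift-step t rt Tr)) j
            fwd : ∀ z s → s ε shift t → (∀ r → r ε shift t → s ⊑ r → z ε comp r j) →
                  s ε u ⊎ (∃[ s′ ] s′ ε t × T ⊑ s′ × s ε shift s′ ⁺) →
                  ∃[ s ] s ε t × (∀ r → r ε t → s ⊑ r → z ε comp r j)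
            -- A tail that starts before `u` contains all shifted times, so the tail from `T` on is
            -- taken.
            fwd z s sε h (inj₁ su) = T , Tt , λ r rt Tr →
              εʳ (same rt Tr) (h (shift r) (shift-step t rt Tr) (⊑-trans (ord-⊑ ou su) (u⊑shift r)))
            fwd z s sε h (inj₂ (s′ , s′t , Ts′ , k)) = s′ , s′t , λ r rt i →
              let Tr = ⊑-trans Ts′ i in
              εʳ (same rt Tr) (h (shift r) (shift-step t rt Tr)
                (⊑-trans (s⊑ (⁺-elim {s} {shift s′} k)) (shift-mono i (ord-ε (isOrd l) s′t) (ord-ε (isOrd l) rt) Ts′)))
              where
              s⊑ : s ε shift s′ ⊎ s ≈ shift s′ → s ⊑ shift s′
              s⊑ (inj₁ k) = ord-⊑ (ord-shift s′) k
              s⊑ (inj₂ e) = ≈⇒⊑ e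
              shift-mono : ∀ {a b} → a ⊑ b → Ord a → Ord b → T ⊑ a → shift a ⊑ shift b
              shift-mono {a} {b} i oa ob Ta =
                [ (λ k → ord-⊑ (ord-shift b) (shift-step b k Ta)) , (λ e → ≈⇒⊑ (shift-cong e)) ]′ (⊑-split oa ob i)
            bwd : ∀ z s → (∀ r → r ε t → s ⊑ r → z ε comp r j) → ∀ d → s ⊑ d → d ε t → ∀ {r} → shift d ⊑ r →
                  ∃[ r′ ] r′ ε t × T ⊑ r′ × r ≈ shift r′ → z ε comp r j
            bwd z s h d sd dt i (r′ , r′t , Tr′ , e) =
              εʳ (≈-sym (≈-trans (comp-cong e j) (same r′t Tr′))) (h r′ r′t (⊑-trans sd d⊑r′))
              where
              d⊑r′ : d ⊑ r′
              d⊑r′ = [ (λ k → ⊥-elim (ε⇒⋢ (shift-step d k Tr′) (⊑-trans i (≈⇒⊑ e)))) , id ]′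
                       (ord-split (ord-ε (isOrd l) r′t) (ord-ε (isOrd l) dt))

        revisit : ∀ {t} → t ε θ ⁺ → u ⊑ t → t ε shift α → ∃[ r ] r ε α × T ⊑ r × (∀ j → comp t j ≈ comp r j)
        revisit {t} tθ i m = go (shift-elim α ord-α m i)
          where
          go : ∃[ r ] r ε α × T ⊑ r × t ≈ shift r → ∃[ r ] r ε α × T ⊑ r × (∀ j → comp t j ≈ comp r j)
          go (r , rα , Tr , e) = r , rα , Tr , λ j →
            ≈-trans (comp-cong e j) (repeats r (⁺-old rα) Tr (εˡ e tθ) j)

        end : V
        end = shift α

        ord-end : Ord end
        ord-end = ord-shift α

        end-ρ : end ε θ ⁺ → ∀ j → comp end j ≈ ρ j
        end-ρ m = repeats α ⁺-new T⊑α m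

        u-end : u ε end
        u-end = εˡ shift-T (shift-step α T-α ⊑-refl)

      -- A phase is a copy of the segment from `T` to `α`, placed at a time `u` with configuration
      -- `ρ`. `Overdue` moves the boundaries: `u` itself is excluded and the end, where the next
      -- phase begins, is included.
      Phase Overdue : V → Set₁
      Phase t   = ∃[ u ] Σ[ m ∈ u ε θ ⁺ ] Σ[ c ∈ (∀ j → comp u j ≈ ρ j) ] u ⊑ t × t ε end m c
      Overdue t = ∃[ u ] Σ[ m ∈ u ε θ ⁺ ] Σ[ c ∈ (∀ j → comp u j ≈ ρ j) ] u ε t × t ⊑ end m c

      restart : ∀ {t} → t ε θ ⁺ → (∀ j → comp t j ≈ ρ j) → Phase t
      restart {t} m c = t , m , c , ⊑-refl , u-end m c

      phase-⊒ : ∀ {t} → t ε θ ⁺ → Phase t → ∀ j → ρ j ⊑ comp t j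
      phase-⊒ tθ (u , m , c , i , k) j = let r , rα , Tr , e = revisit m c tθ i k in
        ⊑-trans (above-T j rα Tr) (≈⇒⊑ (≈-sym (e j)))

      -- An overdue time continues a phase or starts the next one. A time after `T` that is not
      -- overdue cannot be a successor, since the phase of its predecessor would reach it; so it is
      -- a limit before which every phase begun has ended, and a new phase starts there.
      phase : ∀ t → t ε θ ⁺ → T ⊑ t → Phase t
      phase = ε-induction _ λ t ih tθ Tt → decide t ih tθ Tt em
        where
        IH : V → Set₁
        IH t = ∀ s → s ε t → s ε θ ⁺ → T ⊑ s → Phase s

        earlier : ∀ {s t} → t ε θ ⁺ → s ε t → s ε θ ⁺
        earlier = trans₀ (ord-⁺ ord-θ)

        ord-time : ∀ {t} → t ε θ ⁺ → Ord t
        ord-time = ord-ε (ord-⁺ ord-θ)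

        at-successor : ∀ {t} → IH t → t ε θ ⁺ → ¬ Overdue t → T ε t → ∀ s → s ε t → t ≈ s ⁺ → ⊥
        at-successor {t} ih tθ n Tt s sε e = go (ih s sε sθ Ts)
          where
          sθ : s ε θ ⁺
          sθ = earlier tθ sε
          Ts : T ⊑ s
          Ts = [ ord-⊑ (ord-time sθ) , ≈⇒⊑ ]′ (⁺-elim {T} {s} (εʳ e Tt))
          go : Phase s → ⊥
          go (u , m , c , i , k) = n (u , m , c , ⊑-ε (ord-time sθ) (ord-time tθ) i sε (ord-time m) ,
            ⊑-trans (≈⇒⊑ e) (⁺-⊑ (ord-end m c) k))

        -- Values from `T` on are at least `ρ` by `phase-⊒`. They are `ρ` at the ends of phases,
        -- which are cofinal in `t` because every phase begun before `t` also ends before `t`.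
        at-limit : ∀ {t} → IH t → t ε θ ⁺ → ¬ Overdue t → T ε t → Limit t → ∀ j → comp t j ≈ ρ j
        at-limit {t} ih tθ n Tt l j = ext
          (λ z k → let s , sε , h = to (comp-limit tθ l j z) k
                       d , dt , sd , Td = ⊔-exists (isOrd l) sε Tt
                   in go h dt sd (ih d dt (earlier tθ dt) Td))
          (λ z k → from (comp-limit tθ l j z) (T , Tt , λ r rt Tr →
            k ▹ phase-⊒ (earlier tθ rt) (ih r rt (earlier tθ rt) Tr) j))
          where
          go : ∀ {z s d} → (∀ r → r ε t → s ⊑ r → z ε comp r j) → d ε t → s ⊑ d → Phase d → z ε ρ j
          go h dt sd (u , m , c , i , k) = [ (λ q → εʳ (end-ρ m c (earlier tθ q) j) (h (end m c) q (⊑-trans sd (ord-⊑ (ord-end m c) k))))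
                                   , (λ q → ⊥-elim (n (u , m , c , ⊑-ε (ord-time (earlier tθ dt)) (isOrd l) i dt (ord-time m) , q))) ]′
                                   (ord-split (ord-end m c) (isOrd l))

        decide : ∀ t → IH t → t ε θ ⁺ → T ⊑ t → Dec (Overdue t) → Phase t
        decide t ih tθ Tt (yes (u , m , c , ut , i)) =
          [ (λ k → u , m , c , ord-⊑ (ord-time tθ) ut , k)
          , (λ e → restart tθ λ j → ≈-trans (comp-cong e j) (end-ρ m c (εˡ e tθ) j)) ]′
          (⊑-split (ord-time tθ) (ord-end m c) i)
        decide t ih tθ Tt (no n) =
          [ (λ k → cases k (ordinal-cases (ord-time tθ)))
          , (λ e → restart tθ λ j → ≈-trans (comp-cong (≈-sym e) j) (comp-T j)) ]′
          (⊑-split ord-T (ord-time tθ) Tt)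
          where
          cases : T ε t → t ≈ ∅ ⊎ (∃[ s ] s ε t × t ≈ s ⁺) ⊎ Limit t → Phase t
          cases Tt (inj₁ e)                   = ⊥-elim (∅-empty (εʳ e Tt))
          cases Tt (inj₂ (inj₁ (s , sε , e))) = ⊥-elim (at-successor ih tθ n Tt s sε e)
          cases Tt (inj₂ (inj₂ l))            = restart tθ (at-limit ih tθ n Tt l)

      open Program P using (instructionAt)

      -- The halting time lies in a phase too, so its line is one that was active at some `r ε α`,
      -- where the program still had an instruction.
      absurd : ⊥
      absurd = go (phase θ ⁺-new (⊑-trans T⊑α α⊑θ))
        where
        go : Phase θ → ⊥
        go (u , m , c , i , k) =
          let r , rα , _ , e = revisit m c ⁺-new i k
          in just≢nothing (proj₂ (running (rα ▹ α⊑θ)))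
               (trans (cong instructionAt (sym (numeral-inj (e zero)))) (HaltingComputation.halt C))

    -- Determinism and change of oracle

    halts-early : {P : Program} {x ξ : V} → Con x → Con ξ → (C : HaltingComputation α P x ξ) → Run.θ C ε α
    halts-early cx cξ C = [ id , (λ i → ⊥-elim (Loop.absurd cx cξ C i)) ]′ (ord-split (Run.ord-θ C) ord-α)

    -- Collection along `θ ⁺`, which is below `α` because the run halts early.
    registers-bounded : {P : Program} {x ξ : V} → Con x → Con ξ → (C : HaltingComputation α P x ξ) →
                        ∃[ g ] g ε α × (∀ t → t ε Run.θ C ⁺ → ∀ j → Run.comp C t j ε g)
    registers-bounded {P} {x} {ξ} cx cξ C = go (collection θ⁺α Bounds d-Bounds total)
      where
      open Run C
      θ⁺α : θ ⁺ ε α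
      θ⁺α = has-⁺ limit-α (halts-early cx cξ C)
      module Tr = Trace cx cξ C (con-ε con-α θ⁺α) (ord-⁺ ord-θ) ⊑-refl
      Bounds : V → V → Set₁
      Bounds t u = ∀ j a → a ε α → t ε θ ⁺ × a ε α × a ≈ comp t j → a ε u
      d-Bounds : Definable₂ Bounds
      d-Bounds T U = dFin∀ λ j → d∀∈ (! con-α) (Tr.d-comp j (↑ T) v₀ d→ dε v₀ (↑ U))
      total : ∀ t → t ε θ ⁺ → ∃[ u ] u ε α × Bounds t u
      total t m = finite-bound
        (λ j s s′ i h a aα k → h a aα k ▹ i)
        -- The successor, because `Bounds` asks for strict bounds.
        (λ j → comp t j ⁺ , has-⁺ limit-α (comp-α m j) , λ a _ (_ , _ , e) → εˡ (≈-sym e) (⁺-new {comp t j}))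
      go : ∃[ g ] g ε α × (∀ t → t ε θ ⁺ → ∃[ u ] u ε g × Bounds t u) →
           ∃[ g ] g ε α × (∀ t → t ε θ ⁺ → ∀ j → comp t j ε g)
      go (g , gα , h) = g , gα , λ t m j → let u , ug , b = h t m in
        trans₀ (ord-ε ord-α gα) ug (b j (comp t j) (comp-α m j) (m , comp-α m j , ≈-refl))

    -- The oracle is asked only about register contents, all of which lie in `g`, so the same
    -- configurations form a run with oracle `y`.
    change-oracle : {P : Program} {x y ξ g : V} (C : HaltingComputation α P x ξ) →
                    (∀ t → t ε Run.θ C ⁺ → ∀ j → Run.comp C t j ε g) →
                    (∀ z → z ε g → z ε x ⟺ z ε y) → HaltingComputation α P y ξ
    change-oracle {P} {x} {y} C bound agree = record
      { haltingTime   = haltingTime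
      ; ordinal       = ordinal
      ; configuration = configuration
      ; line-cong     = line-cong
      ; regs-cong     = regs-cong
      ; start-line    = start-line
      ; start-regs    = start-regs
      ; step          = λ t m → let ι , e , exec = step t m in ι , e , change ι (λ i → bound t (⁺-old (mk m)) (suc i)) exec
      ; limit-line    = limit-line
      ; limit-regs    = limit-regs
      ; bounded       = bounded
      ; halt          = halt }
      where
      open HaltingComputation C
      change : ∀ ι {c d} → (∀ i → regs c i ε _) → Execute ι x c d → Execute ι y c d
      change (increment i)   b p = p
      change (copy i j)      b p = p
      change (jumpIf≈ i j l) b p = p
      change (oracle i) {c}  b (l , p , q) =
        l , (λ m → p (un (from (agree (regs c i) (b i)) (mk m)))) , (λ n → q λ m → n (un (to (agree (regs c i) (b i)) (mk m))))

    module _ {P : Program} {x ξ : V} (C C′ : HaltingComputation α P x ξ) where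

      private
        module R = Run C
        module R′ = Run C′

      deterministic : ∀ t → t ε R.θ ⁺ → t ε R′.θ ⁺ → ∀ j → R.comp t j ≈ R′.comp t j
      deterministic = ε-induction _ λ t ih m m′ → go t ih m m′ (ordinal-cases (ord-ε (ord-⁺ R.ord-θ) m))
        where
        earlier : ∀ {θ s t} → Ord θ → t ε θ ⁺ → s ε t → s ε θ
        earlier o m k = [ (λ q → trans₀ o q k) , (λ e → εʳ e k) ]′ (⁺-elim m)
        go : ∀ t → (∀ s → s ε t → s ε R.θ ⁺ → s ε R′.θ ⁺ → ∀ j → R.comp s j ≈ R′.comp s j) →
             t ε R.θ ⁺ → t ε R′.θ ⁺ → t ≈ ∅ ⊎ (∃[ s ] s ε t × t ≈ s ⁺) ⊎ Limit t → ∀ j → R.comp t j ≈ R′.comp t j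
        go t ih m m′ (inj₁ e) j =
          ≈-trans (R.comp-cong e j) (≈-trans (R.comp-∅ j) (≈-sym (≈-trans (R′.comp-cong e j) (R′.comp-∅ j))))
        go t ih m m′ (inj₂ (inj₁ (s , sε , e))) j =
          ≈-trans (R.comp-cong e j) (≈-trans
            (same-step C C′ (earlier R.ord-θ m sε) (earlier R′.ord-θ m′ sε)
              (ih s sε (⁺-old (earlier R.ord-θ m sε)) (⁺-old (earlier R′.ord-θ m′ sε))) j)
            (≈-sym (R′.comp-cong e j)))
        go t ih m m′ (inj₂ (inj₂ l)) j = ext
          (λ z k → let s , sε , h = to (R.comp-limit m l j z) k in
            from (R′.comp-limit m′ l j z) (s , sε , λ r rε i → εʳ (same r rε) (h r rε i)))
          (λ z k → let s , sε , h = to (R′.comp-limit m′ l j z) k in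
            from (R.comp-limit m l j z) (s , sε , λ r rε i → εʳ (≈-sym (same r rε)) (h r rε i)))
          where
          same : ∀ r → r ε t → R.comp r j ≈ R′.comp r j
          same r rε = ih r rε (⁺-old (earlier R.ord-θ m rε)) (⁺-old (earlier R′.ord-θ m′ rε)) j

      -- At the earlier halting time both runs are on the same line, where the first finds no
      -- instruction and the second does.
      not-earlier : ¬ R.θ ε R′.θ
      not-earlier m = just≢nothing (proj₂ (R′.running m))
        (trans (cong (Program.instructionAt P) (sym (numeral-inj (deterministic R.θ ⁺-new (⁺-old m) zero))))
               (HaltingComputation.halt C))

      deterministic-end : R.θ ≈ R′.θ → ∀ j → R.comp R.θ j ≈ R′.comp R′.θ j
      deterministic-end e j = ≈-trans (deterministic R.θ ⁺-new (εˡ (≈-sym e) ⁺-new) j) (R′.comp-cong e j)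

    output-unique : {P : Program} {x ξ : V} (C C′ : HaltingComputation α P x ξ) →
                    HaltingComputation.output C ≈ HaltingComputation.output C′
    output-unique C C′ = go (trichotomy (Run.ord-θ C) (Run.ord-θ C′))
      where
      go : Run.θ C ε Run.θ C′ ⊎ Run.θ C ≈ Run.θ C′ ⊎ Run.θ C′ ε Run.θ C →
           HaltingComputation.output C ≈ HaltingComputation.output C′
      go (inj₁ m)        = ⊥-elim (not-earlier C C′ m)
      go (inj₂ (inj₁ e)) = deterministic-end C C′ e (suc zero)
      go (inj₂ (inj₂ m)) = ⊥-elim (not-earlier C′ C m)

    -- The symmetric difference of `x` and the singleton of `g`, cut down to `α`.
    toggle : V → V → V
    toggle g x = sep α λ z → (z ε x × ¬ z ≈ g) ⊎ (¬ z ε x × z ≈ g)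

    toggle⟺ : ∀ {g x z} → z ε toggle g x ⟺ (z ε α × ((z ε x × ¬ z ≈ g) ⊎ (¬ z ε x × z ≈ g)))
    toggle⟺ {g} {x} = mk⟺
      (λ m → let zα , y , e , p = sep-elim m in zα , resp (≈-sym e) p)
      (λ (zα , p) → sep-intro resp zα p)
      where
      resp : ∀ {y z} → y ≈ z → (y ε x × ¬ y ≈ g) ⊎ (¬ y ε x × y ≈ g) → (z ε x × ¬ z ≈ g) ⊎ (¬ z ε x × z ≈ g)
      resp e (inj₁ (m , n)) = inj₁ (εˡ e m , n ∘ ≈-trans e)
      resp e (inj₂ (n , p)) = inj₂ (n ∘ εˡ (≈-sym e) , ≈-trans (≈-sym e) p)

    -- The accepting run on `x` is also a run on `x′`, with output 1, while recognition of `x`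
    -- provides a run on `x′` with output 0; outputs are unique.
    unrecognizable : ∀ {x} → Con x → x ⊑ α → ¬ IsRecognizable α x
    unrecognizable {x} cx x⊑α (P , ξ , ξα , rec) = go (proj₁ (rec x (⊑⇒⊆ x⊑α)) ≈-refl)
      where
      cξ : Con ξ
      cξ = con-ε con-α (mk ξα)
      go : HaltsWith α P x ξ (numeral 1) → ⊥
      go (C , out) = use (registers-bounded cx cξ C)
        where
        use : ∃[ g ] g ε α × (∀ t → t ε Run.θ C ⁺ → ∀ j → Run.comp C t j ε g) → ⊥
        use (g , gα , bound) = clash (proj₂ (rec x′ (⊑⇒⊆ (⊑-intro λ z m → proj₁ (to toggle⟺ m)))) x′≉x)
          where
          x′ : V
          x′ = toggle g x
          x′≉x : ¬ x′ ≈ x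
          x′≉x e = case em₀ {g ε x} of λ
            { (yes m) → [ (λ (_ , n) → n ≈-refl) , (λ (n , _) → n m) ]′ (proj₂ (to toggle⟺ (εʳ (≈-sym e) m)))
            ; (no n)  → n (εʳ e (from toggle⟺ (gα , inj₂ (n , ≈-refl)))) }
          agree : ∀ z → z ε g → z ε x ⟺ z ε x′
          agree z m = mk⟺
            (λ k → from toggle⟺ (k ▹ x⊑α , inj₁ (k , z≉g)))
            (λ k → [ proj₁ , (λ (_ , e) → ⊥-elim (z≉g e)) ]′ (proj₂ (to toggle⟺ k)))
            where
            z≉g : ¬ z ≈ g
            z≉g e = ε-irrefl g (εˡ e m)
          clash : HaltsWith α P x′ ξ (numeral 0) → ⊥
          clash (C′ , out′) = 1≢0 (numeral-inj {1} {0} (≈-trans (≈-sym out)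
            (≈-trans (output-unique (change-oracle C bound agree) C′) out′)))
            where
            1≢0 : 1 ≢ 0
            1≢0 ()

lemma13 : ExcludedMiddle (lsuc 0ℓ) →
    (α : 𝕃) → InL.IsUncountableRegularCardinal α →
    ¬ (∃[ x ] IsConstructible x × x ⊆ proj₁ α × IsRecognizable (proj₁ α) x)
lemma13 em α urc (x , constructible , x⊆α , recognizable) =
  unrecognizable (fromConstructible constructible) (⊆⇒⊑ x⊆α) recognizable
  where
  open Classical em
  open Regular α urc
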